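{- There is an absolute constant $\gamma$ such that every CNF $\varphi$ with $n=|Var(\varphi)|$ variables can be represented as the conjunction of two OBDDs, each having at most $2^{2\gamma\,\Delta(\varphi)\, tw(\varphi)^2}\cdot n$ nodes.
   Context: A CNF $\varphi$ is a set of clauses, each clause a set of literals; $Var(\varphi)$ is the set of its variables. The primal graph $G_\varphi$ has vertex set $Var(\varphi)$, two variables being adjacent iff they occur together in some clause; $tw(\varphi)$ is the treewidth of $G_\varphi$. $\Delta(\varphi)$ is the maximum, over variables $x$, of the number of clauses of $\varphi$ in which $x$ occurs. An OBDD is a DAG (multiple edges allowed) with one source and two sinks labelled $True$ and $False$, in which each non-sink node has two outgoing edges labelled with opposite literals of the same variable, no path contains two edges labelled with literals of the same variable, and there is a linear order $\pi$ of the variables such that along every path the variables appear in increasing $\pi$-order. The function $F(Z)$ computed by OBDD $Z$ has as satisfying assignments exactly the assignments $S$ to $Var(Z)$ (the variables labelling edges) such that some source-to-$True$ path $P$ has all its edge labels in $S$. The conjunction of OBDDs $Z_1,Z_2$ is the function $F(Z_1)\wedge F(Z_2)$; it represents $\varphi$ if it has the same satisfying assignments as $\varphi$. Size is measured by the number of nodes.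
   Formalization: The size of an OBDD counts only its non-sink nodes: with the two sinks counted the bound fails at treewidth 0, e.g. for the CNF {{x}}, where it equals 1. Constant OBDDs, whose source may be a sink or which may miss a sink, are allowed. -}

module Defs where

open import Data.Nat using (ℕ; zero; suc; _≤_; _<_; _⊔_)
open import Data.Nat.Properties using (_≟_)
open import Data.Bool using (Bool; true; false; not; if_then_else_; _∧_; T)
open import Data.Fin using (Fin; toℕ) renaming (zero to fzero; suc to fsuc)
open import Data.List using (List; []; _∷_; map; concatMap; length; filterᵇ; deduplicate; foldr)
open import Data.Bool.ListAction using (all; any)
open import Data.List.Membership.Propositional using (_∈_; _∉_)
open import Data.List.Relation.Unary.AllPairs using (AllPairs)
open import Data.Sum using (_⊎_; inj₁; inj₂)
open import Data.Product using (Σ; _×_; ∃; _,_)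
open import Relation.Nullary using (¬_; does)
open import Relation.Binary.PropositionalEquality using (_≡_; _≢_)
open import Function.Bundles using (_⇔_)

record Literal : Set where
  constructor lit
  field
    var  : ℕ
    sign : Bool      -- true: positive literal x, false: negative literal ¬x
open Literal public

Clause : Set
Clause = List Literal   -- read as the set of its elements

CNF : Set
CNF = List Clause       -- read as the set of its elements

SameClause : Clause → Clause → Set
SameClause C D = (l : Literal) → (l ∈ C) ⇔ (l ∈ D)

-- a list of clauses faithfully represents a *set* of clauses:
-- no clause (as a set of literals) is listed twice
NoDupClauses : CNF → Set
NoDupClauses φ = AllPairs (λ C D → ¬ SameClause C D) φ

Vars : CNF → List ℕ
Vars φ = deduplicate _≟_ (concatMap (map var) φ)

nvars : CNF → ℕ
nvars φ = length (Vars φ)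

occursIn : ℕ → Clause → Bool
occursIn x C = any (λ l → does (var l ≟ x)) C

occ : CNF → ℕ → ℕ
occ φ x = length (filterᵇ (occursIn x) φ)

Δ : CNF → ℕ
Δ φ = foldr _⊔_ 0 (map (occ φ) (Vars φ))

evalLit : (ℕ → Bool) → Literal → Bool
evalLit a l = if sign l then a (var l) else not (a (var l))

evalCNF : (ℕ → Bool) → CNF → Bool
evalCNF a φ = all (any (evalLit a)) φ

Adjacent : CNF → ℕ → ℕ → Set
Adjacent φ x y = x ≢ y × Σ Clause (λ C → C ∈ φ × (x ∈ map var C) × (y ∈ map var C))

-- A tree on nodes Fin (suc s): node 0 is the root and node (fsuc i) has
-- parent (parent i), whose index is ≤ toℕ i, i.e. smaller than that of
-- fsuc i.  (Every finite tree admits such a numbering.)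
-- A tree decomposition of G_φ of width ≤ k (all bags of size ≤ k + 1).
-- t is a "top" node of the set of nodes whose bag contains x:
-- x ∈ bag t, and t is the root or x ∉ bag (parent of t)
Top : {s : ℕ} → (Fin s → Fin (suc s)) → (Fin (suc s) → List ℕ) → ℕ → Fin (suc s) → Set
Top parent bag x fzero    = x ∈ bag fzero
Top parent bag x (fsuc i) = x ∈ bag (fsuc i) × x ∉ bag (parent i)

record TreeDecomp (φ : CNF) (k : ℕ) : Set where
  field
    s        : ℕ
    parent   : Fin s → Fin (suc s)
    parent<  : (i : Fin s) → toℕ (parent i) ≤ toℕ i
    bag      : Fin (suc s) → List ℕ
    bag⊆V    : (t : Fin (suc s)) (x : ℕ) → x ∈ bag t → x ∈ Vars φ
    width≤   : (t : Fin (suc s)) → length (bag t) ≤ suc k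
    covers   : (x : ℕ) → x ∈ Vars φ → ∃ λ t → x ∈ bag t
    edges    : (x y : ℕ) → Adjacent φ x y → ∃ λ t → x ∈ bag t × y ∈ bag t
    -- the nodes whose bag contains x induce a connected subtree
    -- (⇔ that set has a unique top node)
    connected : (x : ℕ) (t u : Fin (suc s)) → Top parent bag x t → Top parent bag x u → t ≡ u

IsTreewidth : CNF → ℕ → Set
IsTreewidth φ k = TreeDecomp φ k × ((j : ℕ) → j < k → ¬ TreeDecomp φ j)

-- OBDDs.  Internal (decision) nodes are Fin size; a target is either an
-- internal node (inj₁) or a sink (inj₂ b, the sink labelled b).
-- Internal node i is labelled with variable label i; its edge labelled ¬(label i)
-- goes to lo i and its edge labelled (label i) goes to hi i.

Target : ℕ → Set
Target s = Fin s ⊎ Bool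

data Reach {s : ℕ} (lo hi : Fin s → Target s) : Target s → Target s → Set where
  here  : (t : Target s) → Reach lo hi t t
  viaLo : (i : Fin s) (t : Target s) → Reach lo hi (lo i) t → Reach lo hi (inj₁ i) t
  viaHi : (i : Fin s) (t : Target s) → Reach lo hi (hi i) t → Reach lo hi (inj₁ i) t

record OBDD : Set where
  field
    size     : ℕ                -- number of (non-sink) nodes
    label    : Fin size → ℕ
    lo hi    : Fin size → Target size
    source   : Target size
    -- every node is reachable from the source (single source)
    reachable : (i : Fin size) → Reach lo hi source (inj₁ i)
    -- the variable order π, given by an injective rank
    rank     : ℕ → ℕ
    rank-inj : (x y : ℕ) → rank x ≡ rank y → x ≡ y
    ordered-lo : (i j : Fin size) → lo i ≡ inj₁ j → rank (label i) < rank (label j)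
    ordered-hi : (i j : Fin size) → hi i ≡ inj₁ j → rank (label i) < rank (label j)

  data Accepts (a : ℕ → Bool) : Target size → Set where
    atTrue : Accepts a (inj₂ true)
    goLo   : (i : Fin size) → a (label i) ≡ false → Accepts a (lo i) → Accepts a (inj₁ i)
    goHi   : (i : Fin size) → a (label i) ≡ true  → Accepts a (hi i) → Accepts a (inj₁ i)

  Computes : (ℕ → Bool) → Set
  Computes a = Accepts a source

  VarZ : ℕ → Set
  VarZ x = ∃ λ i → label i ≡ x

open OBDD public using (size)

Represents : CNF → OBDD → OBDD → Set
Represents φ Z₁ Z₂ =
    ((x : ℕ) → x ∈ Vars φ → OBDD.VarZ Z₁ x ⊎ OBDD.VarZ Z₂ x)
  × ((x : ℕ) → OBDD.VarZ Z₁ x → x ∈ Vars φ)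
  × ((x : ℕ) → OBDD.VarZ Z₂ x → x ∈ Vars φ)
  × ((a : ℕ → Bool) → T (evalCNF a φ) ⇔ (OBDD.Computes Z₁ a × OBDD.Computes Z₂ a))

{-# OPTIONS --safe #-}

-- A CNF whose primal graph has a tree decomposition with bags of size at most κ = k + 1 has a
-- tree partition of width O(Δ κ²): the variables fall into bags forming a rooted forest such that
-- every clause lies in the union of a bag and its parent. It is built top-down. Given a set S of at
-- most 3κ·Δκ variables that must go into the root bag, cut the decomposition at O(|S|/κ) nodes so
-- that every remaining component sees at most 3κ variables of S and of the cut bags. The root bag
-- is S together with the cut bags, and the variables of a component sharing a clause with the
-- root bag, at most 3κ·Δκ many, are the set S of that component.
--
-- The bags at even depth with their children form disjoint stars. An OBDD reads the stars one
-- after the other, a centre first and then each child in turn, and never remembers more than two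
-- bags, so it can check the clauses between the bags at even depth and their children. A second OBDD
-- does the same for the bags at odd depth.
module Submission where

open import Defs
open import Data.Nat using (ℕ; _*_; _^_; _≤_)
open import Data.Product using (Σ; _×_)
import Algebra.Solver.CommutativeMonoid as CommutativeMonoidSolver
open import Data.Bool using (Bool; true; false; _∧_; T)
open import Data.Bool.ListAction using (any)
open import Data.Bool.Properties using (T-∧) renaming (_≟_ to _≟ᴮ_)
open import Data.Fin as Fin using (Fin; toℕ; fromℕ<)
import Data.Fin.Properties as Fin
open import Data.List
  using (List; []; _∷_; [_]; map; _++_; _ʳ++_; length; drop; lookup; filter; filterᵇ; foldr; concatMap; deduplicate)
open import Data.List.Membership.Propositional using (_∈_; _∉_; find; lose)
open import Data.List.Membership.Propositional.Properties
  using ( ∈-++⁺ˡ; ∈-++⁺ʳ; ∈-++⁻; ∈-map⁺; ∈-map⁻; ∈-lookup; ∈-length; ∈-∃++; ∈-filter⁺; ∈-filter⁻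
        ; ∈-concatMap⁺; ∈-concatMap⁻; ∈-deduplicate⁺; ∈-deduplicate⁻)
open import Data.List.Membership.Propositional.Properties.WithK using (unique⇒irrelevant; unique∧set⇒bag)
open import Data.List.Properties
  using ( drop-map; length-map; length-++; length-filter; length-deduplicate; ++-identityʳ; ++-assoc
        ; concatMap-++; concatMap-map; filter-++; filter-none)
  renaming (≡-dec to list-≡-dec)
open import Data.List.Relation.Binary.BagAndSetEquality using (∼bag⇒↭)
open import Data.List.Relation.Binary.Permutation.Propositional
  using (_↭_; prep; swap; ↭-refl; ↭-reflexive; ↭-sym; ↭-trans; ↭⇒↭ₛ; module PermutationReasoning)
open import Data.List.Relation.Binary.Permutation.Propositional.Properties
  using (↭-length; ∈-resp-↭; ++⁺; ++⁺ˡ; ++⁺ʳ; ++↭ʳ++; ++-commutativeMonoid; filter-↭; shift)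
import Data.List.Relation.Binary.Permutation.Setoid.Properties as ↭ₛ
open import Data.List.Relation.Binary.Subset.Propositional using (_⊆_)
open import Data.List.Relation.Unary.All as All using (All; []; _∷_; all?)
import Data.List.Relation.Unary.All.Properties as All
open import Data.List.Relation.Unary.AllPairs using ([]; _∷_)
open import Data.List.Relation.Unary.Any using (Any; here; there; index; any?)
open import Data.List.Relation.Unary.Any.Properties using (any⁺; any⁻)
open import Data.List.Relation.Unary.Unique.Propositional using (Unique)
import Data.List.Relation.Unary.Unique.DecPropositional.Properties as UniqueDec
import Data.List.Relation.Unary.Unique.Propositional.Properties as Unique
open import Data.Nat using (zero; suc; _+_; _<_; _⊔_; z≤n; s≤s; z<s; s<s)
open import Data.Nat.Properties
open import Data.List.Membership.DecPropositional _≟_ using (_∈?_)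
open import Data.Nat.Tactic.RingSolver using (solve-∀)
open import Data.Product using (_,_; proj₁; proj₂; ∃)
open import Data.Product.Properties using () renaming (≡-dec to ×-≡-dec)
open import Data.Sum as Sum using (_⊎_; inj₁; inj₂; map₁; map₂)
open import Data.Sum.Function.Propositional using (_⊎-↔_)
open import Data.Unit using (⊤; tt)
open import Function using (_∘_; id)
open import Function.Bundles using (_⇔_; mk⇔; _↔_; Inverse; Equivalence)
open import Function.Construct.Composition using (_↔-∘_)
open import Function.Construct.Identity using (↔-id)
open import Relation.Binary.PropositionalEquality as ≡
  using (_≡_; _≢_; refl; sym; trans; cong; cong₂; subst; setoid)
open import Relation.Nullary using (¬_; Dec; yes; no; contradiction)
open import Relation.Nullary.Decidable using (¬?; T?)
open import Relation.Unary using (Decidable)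

-- The exponent pays for the width of the tree partition, so the number of variables forced into a
-- root bag must not grow down the recursion. A child bag has to take in all neighbours of the
-- variables through which its component touches the cutset. If that contact set grew with |S|, each
-- level would multiply it by the number of neighbours. Cutting caps it at a multiple of κ, whatever
-- |S| is. The price is bounded because a mark is only made where more than 2κ contacts have
-- accumulated: the marked bag replaces them, and it is paid for twice, as a bag of the cutset and
-- as a contact of the component above. All marks except the root, which is always marked, therefore
-- have total size at most |S|.
--
-- The nodes of an OBDD are the memory contents that occur before a read. Every node must be
-- reachable, so contents that cannot occur are left out. A program that always rejects may then
-- lose some of its variables, although the two OBDDs together must mention all of them.
--
-- Treewidth 0 is treated apart: there the exponent vanishes, while bags still have κ = 1 variable.

private variable
  A B : Set

Unique⊆⇒length≤ : {xs ys : List A} → Unique xs → xs ⊆ ys → length xs ≤ length ys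
Unique⊆⇒length≤ [] _ = z≤n
Unique⊆⇒length≤ {xs = x ∷ xs} (x∉xs ∷ xs!) sub with ∈-∃++ (sub (here refl))
... | ys₁ , ys₂ , refl = subst (suc (length xs) ≤_) (sym (↭-length ys↭))
        (s≤s (Unique⊆⇒length≤ xs! λ y∈xs → strip (λ where refl → All.lookup x∉xs y∈xs refl)
                                                (∈-resp-↭ ys↭ (sub (there y∈xs)))))
  where
  ys↭ = shift x ys₁ ys₂
  strip : ∀ {y zs} → y ≢ x → y ∈ x ∷ zs → y ∈ zs
  strip y≢x (here y≡x) = contradiction y≡x y≢x
  strip y≢x (there y∈) = y∈

-- Programs reading the variables in a fixed order

-- An environment is the stack of the variables in memory with their values.
Env : Set
Env = List (ℕ × Bool)

_≟ᴱ_ : (e f : Env) → Dec (e ≡ f)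
_≟ᴱ_ = list-≡-dec (×-≡-dec _≟_ _≟ᴮ_)

value : Env → ℕ → Bool
-- A default for variables outside memory; `Fits` ensures that no check looks one up.
value []            x = false
value ((y , b) ∷ e) x with x ≟ y
... | yes _ = b
... | no _  = value e x

data Instr : Set where
  read   : ℕ → Instr
  check  : CNF → Instr
  forget : ℕ → Instr

Prog : Set
Prog = List Instr

run : (ℕ → Bool) → Prog → Env → Bool
run a []             e = true
run a (read x ∷ p)   e = run a p ((x , a x) ∷ e)
run a (check Φ ∷ p)  e = evalCNF (value e) Φ ∧ run a p e
run a (forget j ∷ p) e = run a p (drop j e)

reads : Prog → List ℕ
reads []             = []
reads (read x ∷ p)   = x ∷ reads p
reads (check Φ ∷ p)  = reads p
reads (forget j ∷ p) = reads p

checks : Prog → CNF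
checks []             = []
checks (read x ∷ p)   = checks p
checks (check Φ ∷ p)  = Φ ++ checks p
checks (forget j ∷ p) = checks p

-- L is what p finds in memory at its start.
Fits : ℕ → List ℕ → Prog → Set
Fits m L []             = ⊤
Fits m L (read x ∷ p)   = length L ≤ m × Fits m (x ∷ L) p
Fits m L (check Φ ∷ p)  = (∀ {C} → C ∈ Φ → map var C ⊆ L) × Fits m L p
Fits m L (forget j ∷ p) = Fits m (drop j L) p

snapshot : (ℕ → Bool) → List ℕ → Env
snapshot a = map λ x → x , a x

value-snapshot : ∀ a {x L} → x ∈ L → value (snapshot a L) x ≡ a x
value-snapshot a {x} {y ∷ L} x∈ with x ≟ y
value-snapshot a {x} {y ∷ L} x∈         | yes refl = refl
value-snapshot a {x} {y ∷ L} (here x≡y) | no x≢y   = contradiction x≡y x≢y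
value-snapshot a {x} {y ∷ L} (there x∈) | no x≢y   = value-snapshot a x∈

any-evalLit-cong : ∀ {a b} C → (∀ {x} → x ∈ map var C → a x ≡ b x) → any (evalLit a) C ≡ any (evalLit b) C
any-evalLit-cong []            a≗b = refl
any-evalLit-cong (lit x s ∷ C) a≗b
  rewrite a≗b (here refl) | any-evalLit-cong C (a≗b ∘ there) = refl

evalCNF-cong : ∀ {a b} Φ → (∀ {C x} → C ∈ Φ → x ∈ map var C → a x ≡ b x) → evalCNF a Φ ≡ evalCNF b Φ
evalCNF-cong []      a≗b = refl
evalCNF-cong (C ∷ Φ) a≗b =
  cong₂ _∧_ (any-evalLit-cong C (a≗b (here refl))) (evalCNF-cong Φ (a≗b ∘ there))

evalCNF-++ : ∀ a Φ Ψ → evalCNF a (Φ ++ Ψ) ≡ evalCNF a Φ ∧ evalCNF a Ψ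
evalCNF-++ a []      Ψ = refl
evalCNF-++ a (C ∷ Φ) Ψ with any (evalLit a) C
... | true  = evalCNF-++ a Φ Ψ
... | false = refl

-- In a program that fits, memory is always a snapshot of `a`, and each check only looks at names in
-- it. So every clause is evaluated under `a` itself, however much has been forgotten.
run-snapshot : ∀ a {m} L p → Fits m L p → run a p (snapshot a L) ≡ evalCNF a (checks p)
run-snapshot a L []             _           = refl
run-snapshot a L (read x ∷ p)   (_ , fits)  = run-snapshot a (x ∷ L) p fits
run-snapshot a L (check Φ ∷ p)  (Φ⊆ , fits) = trans
  (cong₂ _∧_ (evalCNF-cong Φ (λ C∈ x∈ → value-snapshot a (Φ⊆ C∈ x∈))) (run-snapshot a L p fits))
  (sym (evalCNF-++ a Φ (checks p)))
run-snapshot a L (forget j ∷ p) fits        =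
  trans (cong (run a p) (drop-map j L)) (run-snapshot a (drop j L) p fits)

extend : Bool → ℕ → Env → Env
extend b x e = (x , b) ∷ e

envs : List ℕ → List Env
envs []      = [ [] ]
envs (x ∷ L) = map (extend false x) (envs L) ++ map (extend true x) (envs L)

∈-envs : ∀ e → e ∈ envs (map proj₁ e)
∈-envs []                = here refl
∈-envs ((x , false) ∷ e) = ∈-++⁺ˡ (∈-map⁺ _ (∈-envs e))
∈-envs ((x , true) ∷ e)  = ∈-++⁺ʳ _ (∈-map⁺ _ (∈-envs e))

length-envs : ∀ L → length (envs L) ≡ 2 ^ length L
length-envs []      = refl
length-envs (x ∷ L)
  rewrite length-++ (map (extend false x) (envs L)) {map (extend true x) (envs L)}
        | length-map (extend false x) (envs L) | length-map (extend true x) (envs L)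
        | length-envs L | +-identityʳ (2 ^ length L) = refl

length≤2^ : ∀ {L} {Q : List Env} → Unique Q → (∀ {e} → e ∈ Q → map proj₁ e ≡ L) → length Q ≤ 2 ^ length L
length≤2^ {L} Q! Q⊆ = ≤-trans (Unique⊆⇒length≤ Q! (λ {e} e∈ → subst (λ L → e ∈ envs L) (Q⊆ e∈) (∈-envs e)))
                              (≤-reflexive (length-envs L))

-- The order of an OBDD must be injective on all of ℕ, so names outside the list come after it,
-- ordered by their own value.
rankIn : List ℕ → ℕ → ℕ
rankIn []       x = x
rankIn (y ∷ ys) x with x ≟ y
... | yes _ = 0
... | no _  = suc (rankIn ys x)

rankIn-injective : ∀ ys x y → rankIn ys x ≡ rankIn ys y → x ≡ y
rankIn-injective []       x y eq = eq
rankIn-injective (z ∷ ys) x y eq with x ≟ z | y ≟ z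
... | yes refl | yes refl = refl
... | no _     | no _     = rankIn-injective ys x y (suc-injective eq)

rankIn-tail-< : ∀ {y ys u v} → Unique (y ∷ ys) → u ∈ ys → v ∈ ys →
                rankIn ys u < rankIn ys v → rankIn (y ∷ ys) u < rankIn (y ∷ ys) v
rankIn-tail-< {y} {u = u} {v} (y∉ ∷ _) u∈ v∈ u<v with u ≟ y | v ≟ y
... | no _     | no _     = s<s u<v
... | yes refl | _        = contradiction refl (All.lookup y∉ u∈)
... | no _     | yes refl = contradiction refl (All.lookup y∉ v∈)

rankIn-head-< : ∀ {y ys v} → Unique (y ∷ ys) → v ∈ ys → rankIn (y ∷ ys) y < rankIn (y ∷ ys) v
rankIn-head-< {y} {v = v} (y∉ ∷ _) v∈ with y ≟ y | v ≟ y
... | no y≢y | _        = contradiction refl y≢y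
... | yes _  | yes refl = contradiction refl (All.lookup y∉ v∈)
... | yes _  | no _     = z<s

-- The levels of an OBDD running a program from any of a list of environments

module _ {Node : Set} (label : Node → ℕ) (next : Bool → Node → Node ⊎ Bool) where

  data Path : Node ⊎ Bool → Node ⊎ Bool → Set where
    stop : ∀ {t} → Path t t
    step : ∀ b i {t} → Path (next b i) t → Path (inj₁ i) t

  data Accepting (a : ℕ → Bool) : Node ⊎ Bool → Set where
    accept : Accepting a (inj₂ true)
    step   : ∀ i → Accepting a (next (a (label i)) i) → Accepting a (inj₁ i)

-- `Q` stands for the memory contents with which the run can arrive at `p`. Each is one entry, so
-- histories that leave the same memory share all later nodes. The second alternative of `full`
-- covers the labels that are lost when every entry rejects.
record Diagram (p : Prog) (Q : List Env) : Set₁ where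
  field
    Node     : Set
    count    : ℕ
    Fin↔Node : Fin count ↔ Node
    label    : Node → ℕ
    next     : Bool → Node → Node ⊎ Bool
    enter    : ∀ {e} → e ∈ Q → Node ⊎ Bool
    label∈   : ∀ i → label i ∈ reads p
    ordered  : ∀ b i j → next b i ≡ inj₁ j → rankIn (reads p) (label i) < rankIn (reads p) (label j)
    reached  : ∀ i → ∃ λ e → Σ (e ∈ Q) λ e∈ → Path label next (enter e∈) (inj₁ i)
    sound    : ∀ a {e} (e∈ : e ∈ Q) → Accepting label next a (enter e∈) → T (run a p e)
    complete : ∀ a {e} (e∈ : e ∈ Q) → T (run a p e) → Accepting label next a (enter e∈)
    full     : (∀ {x} → x ∈ reads p → ∃ λ i → label i ≡ x) ⊎ (∀ a {e} → e ∈ Q → ¬ T (run a p e))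
    bound    : ∀ m {L} → Fits m L p → (∀ {e} → e ∈ Q → map proj₁ e ≡ L) → count ≤ 2 ^ m * length (reads p)

module _ (x : ℕ) (Q : List Env) where

  readFrom : List Env
  readFrom = deduplicate _≟ᴱ_ (map (extend false x) Q ++ map (extend true x) Q)

  ∈-readFrom⁺ : ∀ b {e} → e ∈ Q → extend b x e ∈ readFrom
  ∈-readFrom⁺ false e∈ = ∈-deduplicate⁺ _≟ᴱ_ (∈-++⁺ˡ (∈-map⁺ _ e∈))
  ∈-readFrom⁺ true  e∈ = ∈-deduplicate⁺ _≟ᴱ_ (∈-++⁺ʳ _ (∈-map⁺ _ e∈))

  ∈-readFrom⁻ : ∀ {f} → f ∈ readFrom → ∃ λ b → ∃ λ e → e ∈ Q × f ≡ extend b x e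
  ∈-readFrom⁻ f∈ with ∈-++⁻ (map (extend false x) Q) (∈-deduplicate⁻ _≟ᴱ_ _ f∈)
  ... | inj₁ f∈ˡ = false , ∈-map⁻ _ f∈ˡ
  ... | inj₂ f∈ʳ = true  , ∈-map⁻ _ f∈ʳ

checkFrom : CNF → List Env → List Env
checkFrom Φ Q = filter (λ e → T? (evalCNF (value e) Φ)) Q

forgetFrom : ℕ → List Env → List Env
forgetFrom j Q = deduplicate _≟ᴱ_ (map (drop j) Q)

index-∈-lookup : (xs : List A) (i : Fin (length xs)) → index (∈-lookup {xs = xs} i) ≡ i
index-∈-lookup (x ∷ xs) Fin.zero    = refl
index-∈-lookup (x ∷ xs) (Fin.suc i) = cong Fin.suc (index-∈-lookup xs i)

null⊎index : (xs : List A) → xs ≡ [] ⊎ Fin (length xs)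
null⊎index []      = inj₁ refl
null⊎index (x ∷ _) = inj₂ Fin.zero

lookup-index≡ : {xs : List A} {x : A} (x∈ : x ∈ xs) → lookup xs (index x∈) ≡ x
lookup-index≡ (here refl) = refl
lookup-index≡ (there x∈)  = lookup-index≡ x∈

-- A read adds one level with a node for each environment of `Q`. These all hold the same names `L`,
-- so there are at most 2 to the power |L| of them.
readDiagram : ∀ {x p Q} → Unique (x ∷ reads p) → Unique Q →
              Diagram p (readFrom x Q) → Diagram (read x ∷ p) Q
readDiagram {x} {p} {Q} xp! Q! D = record
  { Node     = Node
  ; count    = length Q + D.count
  ; Fin↔Node = (↔-id _ ⊎-↔ D.Fin↔Node) ↔-∘ Fin.+↔⊎
  ; label    = label
  ; next     = next
  ; enter    = λ e∈ → inj₁ (inj₁ (index e∈))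
  ; label∈   = λ where (inj₁ i) → here refl
                       (inj₂ i) → there (D.label∈ i)
  ; ordered  = ordered
  ; reached  = reached
  ; sound    = sound
  ; complete = complete
  ; full     = full
  ; bound    = bound
  }
  where
  module D = Diagram D
  Node = Fin (length Q) ⊎ D.Node
  label : Node → ℕ
  label (inj₁ i) = x
  label (inj₂ i) = D.label i
  entry : Bool → Fin (length Q) → D.Node ⊎ Bool
  entry b i = D.enter (∈-readFrom⁺ x Q b (∈-lookup i))
  next : Bool → Node → Node ⊎ Bool
  next b (inj₁ i) = map₁ inj₂ (entry b i)
  next b (inj₂ i) = map₁ inj₂ (D.next b i)

  inj₂-image : ∀ {t : D.Node ⊎ Bool} {j : Node} → map₁ inj₂ t ≡ inj₁ j → ∃ λ j′ → j ≡ inj₂ j′ × t ≡ inj₁ j′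
  inj₂-image {inj₁ j′} refl = j′ , refl , refl

  ordered : ∀ b i j → next b i ≡ inj₁ j → rankIn (x ∷ reads p) (label i) < rankIn (x ∷ reads p) (label j)
  ordered b (inj₁ i) j eq with inj₂-image {entry b i} eq
  ... | j′ , refl , _ = rankIn-head-< xp! (D.label∈ j′)
  ordered b (inj₂ i) j eq with inj₂-image {D.next b i} eq
  ... | j′ , refl , eq′ = rankIn-tail-< xp! (D.label∈ i) (D.label∈ j′) (D.ordered b i j′ eq′)

  lift : ∀ {t u} → Path D.label D.next t u → Path label next (map₁ inj₂ t) (map₁ inj₂ u)
  lift stop         = stop
  lift (step b i r) = step b (inj₂ i) (lift r)

  reached : ∀ i → ∃ λ e → Σ (e ∈ Q) λ e∈ → Path label next (inj₁ (inj₁ (index e∈))) (inj₁ i)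
  reached (inj₁ i) = _ , ∈-lookup i ,
    subst (λ j → Path label next (inj₁ (inj₁ j)) (inj₁ (inj₁ i))) (sym (index-∈-lookup Q i)) stop
  reached (inj₂ i) with D.reached i
  ... | f , f∈ , r with ∈-readFrom⁻ x Q f∈
  -- The edge enters the next level by the membership proof built from `∈-lookup`, not by `f∈`. As
  -- `readFrom` has no repetitions, the two proofs coincide.
  ... | b , e , e∈ , refl = e , e∈ , step b (inj₁ (index e∈)) (go (lookup-index≡ e∈) (∈-lookup (index e∈)))
    where
    go : ∀ {e′} → e′ ≡ e → (e′∈ : e′ ∈ Q) →
         Path label next (map₁ inj₂ (D.enter (∈-readFrom⁺ x Q b e′∈))) (inj₁ (inj₂ i))
    go refl e′∈ = subst (λ f∈ → Path label next (map₁ inj₂ (D.enter f∈)) _)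
                        (unique⇒irrelevant (UniqueDec.deduplicate-! _≟ᴱ_ _) f∈ _) (lift r)

  lower : ∀ a {t} → Accepting label next a (map₁ inj₂ t) → Accepting D.label D.next a t
  lower a {inj₂ true} accept     = accept
  lower a {inj₁ i}    (step _ r) = step i (lower a r)
  raise : ∀ a {t} → Accepting D.label D.next a t → Accepting label next a (map₁ inj₂ t)
  raise a accept     = accept
  raise a (step i r) = step (inj₂ i) (raise a r)

  sound : ∀ a {e} (e∈ : e ∈ Q) → Accepting label next a (inj₁ (inj₁ (index e∈))) → T (run a p (extend (a x) x e))
  sound a {e} e∈ (step _ r) = subst (λ e → T (run a p (extend (a x) x e))) (lookup-index≡ e∈)
                                    (D.sound a _ (lower a r))
  complete : ∀ a {e} (e∈ : e ∈ Q) → T (run a p (extend (a x) x e)) → Accepting label next a (inj₁ (inj₁ (index e∈)))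
  complete a {e} e∈ r = step _ (raise a (D.complete a _
    (subst (λ e → T (run a p (extend (a x) x e))) (sym (lookup-index≡ e∈)) r)))

  full : (∀ {y} → y ∈ x ∷ reads p → ∃ λ i → label i ≡ y) ⊎ (∀ a {e} → e ∈ Q → ¬ T (run a p (extend (a x) x e)))
  full with D.full | null⊎index Q
  ... | inj₂ never | _         = inj₂ λ a e∈ → never a (∈-readFrom⁺ x Q (a x) e∈)
  -- Without environments no node is labelled `x`, but then rejection is vacuous.
  ... | inj₁ _     | inj₁ refl = inj₂ λ _ ()
  ... | inj₁ cover | inj₂ i    = inj₁ λ where
    (here refl) → inj₁ i , refl
    (there y∈)  → let j , eq = cover y∈ in inj₂ j , eq

  bound : ∀ m {L} → length L ≤ m × Fits m (x ∷ L) p → (∀ {e} → e ∈ Q → map proj₁ e ≡ L) →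
          length Q + D.count ≤ 2 ^ m * suc (length (reads p))
  bound m {L} (L≤m , fits) Q⊆ = begin
    length Q + D.count
      ≤⟨ +-mono-≤ (≤-trans (length≤2^ Q! Q⊆) (^-monoʳ-≤ 2 L≤m)) (D.bound m fits names) ⟩
    2 ^ m + 2 ^ m * length (reads p) ≡⟨ *-suc (2 ^ m) _ ⟨
    2 ^ m * suc (length (reads p))   ∎
    where
    open ≤-Reasoning
    names : ∀ {f} → f ∈ readFrom x Q → map proj₁ f ≡ x ∷ L
    names f∈ with ∈-readFrom⁻ x Q f∈
    ... | b , e , e∈ , refl = cong (x ∷_) (Q⊆ e∈)

-- A check adds no nodes: an entry that fails it is sent to the sink `False`, and only the others
-- are passed on.
checkDiagram : ∀ {Φ p Q} → Unique Q → Diagram p (checkFrom Φ Q) → Diagram (check Φ ∷ p) Q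
checkDiagram {Φ} {p} {Q} Q! D = record
  { D
  ; enter    = λ {e} e∈ → enterIf e∈ (holds? e)
  ; reached  = λ i → let e , e∈ , r = D.reached i ; e∈Q , ok = ∈-filter⁻ holds? e∈ in
                 e , e∈Q , reachIf e∈Q (holds? e) ok e∈ r
  ; sound    = λ a {e} e∈ → Equivalence.from T-∧ ∘ soundIf a e∈ (holds? e)
  ; complete = λ a {e} e∈ r → let ok , r′ = Equivalence.to T-∧ r in completeIf a e∈ (holds? e) ok r′
  ; full     = map₂ (λ never a e∈ r → let ok , r′ = Equivalence.to T-∧ r in
                 never a (∈-filter⁺ holds? e∈ ok) r′) D.full
  ; bound    = λ m (_ , fits) Q⊆ → D.bound m fits (Q⊆ ∘ proj₁ ∘ ∈-filter⁻ holds?)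
  }
  where
  module D = Diagram D
  holds? = λ e → T? (evalCNF (value e) Φ)
  enterIf : ∀ {e} → e ∈ Q → Dec (T (evalCNF (value e) Φ)) → D.Node ⊎ Bool
  enterIf e∈ (yes ok) = D.enter (∈-filter⁺ holds? e∈ ok)
  enterIf e∈ (no _)   = inj₂ false
  reachIf : ∀ {e i} (e∈ : e ∈ Q) d → T (evalCNF (value e) Φ) → (e∈′ : e ∈ checkFrom Φ Q) →
            Path D.label D.next (D.enter e∈′) (inj₁ i) → Path D.label D.next (enterIf e∈ d) (inj₁ i)
  reachIf e∈ (yes ok) _  e∈′ r = subst (λ e∈ → Path D.label D.next (D.enter e∈) _)
    (unique⇒irrelevant (Unique.filter⁺ holds? Q!) e∈′ _) r
  reachIf e∈ (no ¬ok) ok _   _ = contradiction ok ¬ok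
  soundIf : ∀ a {e} (e∈ : e ∈ Q) d → Accepting D.label D.next a (enterIf e∈ d) →
            T (evalCNF (value e) Φ) × T (run a p e)
  soundIf a e∈ (yes ok) r = ok , D.sound a _ r
  completeIf : ∀ a {e} (e∈ : e ∈ Q) d → T (evalCNF (value e) Φ) → T (run a p e) →
               Accepting D.label D.next a (enterIf e∈ d)
  completeIf a e∈ (yes ok) _  r = D.complete a _ r
  completeIf a e∈ (no ¬ok) ok r = contradiction ok ¬ok

-- This is where an OBDD saves nodes: environments that differ only in the forgotten names get the
-- same entry.
forgetDiagram : ∀ {j p Q} → Diagram p (forgetFrom j Q) → Diagram (forget j ∷ p) Q
forgetDiagram {j} {p} {Q} D = record
  { D
  ; enter    = D.enter ∘ drop∈
  ; reached  = reached
  ; sound    = λ a e∈ → D.sound a (drop∈ e∈)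
  ; complete = λ a e∈ → D.complete a (drop∈ e∈)
  ; full     = map₂ (λ never a e∈ → never a (drop∈ e∈)) D.full
  ; bound    = λ m fits Q⊆ → D.bound m fits (names Q⊆)
  }
  where
  module D = Diagram D
  drop∈ : ∀ {e} → e ∈ Q → drop j e ∈ forgetFrom j Q
  drop∈ e∈ = ∈-deduplicate⁺ _≟ᴱ_ (∈-map⁺ (drop j) e∈)
  drop∈⁻ : ∀ {f} → f ∈ forgetFrom j Q → ∃ λ e → e ∈ Q × f ≡ drop j e
  drop∈⁻ f∈ = ∈-map⁻ (drop j) (∈-deduplicate⁻ _≟ᴱ_ (map (drop j) Q) f∈)
  reached : ∀ i → ∃ λ e → Σ (e ∈ Q) λ e∈ → Path D.label D.next (D.enter (drop∈ e∈)) (inj₁ i)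
  reached i with D.reached i
  ... | f , f∈ , r with drop∈⁻ f∈
  ... | e , e∈ , refl = e , e∈ , subst (λ f∈ → Path D.label D.next (D.enter f∈) _)
                                       (unique⇒irrelevant (UniqueDec.deduplicate-! _≟ᴱ_ _) f∈ _) r
  names : ∀ {L} → (∀ {e} → e ∈ Q → map proj₁ e ≡ L) → ∀ {f} → f ∈ forgetFrom j Q → map proj₁ f ≡ drop j L
  names Q⊆ f∈ with drop∈⁻ f∈
  ... | e , e∈ , refl = trans (sym (drop-map j e)) (cong (drop j) (Q⊆ e∈))

diagram : ∀ p Q → Unique (reads p) → Unique Q → Diagram p Q
diagram []             Q p! Q! = record
  { Node = Fin 0 ; count = 0 ; Fin↔Node = ↔-id _ ; label = λ () ; next = λ _ () ; enter = λ _ → inj₂ true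
  ; label∈ = λ () ; ordered = λ _ () ; reached = λ () ; sound = λ _ _ _ → tt ; complete = λ _ _ _ → accept
  ; full = inj₁ λ () ; bound = λ _ _ _ → z≤n }
diagram (read x ∷ p)   Q (x∉ ∷ p!) Q! =
  readDiagram (x∉ ∷ p!) Q! (diagram p _ p! (UniqueDec.deduplicate-! _≟ᴱ_ _))
diagram (check Φ ∷ p)  Q p! Q! =
  checkDiagram Q! (diagram p _ p! (Unique.filter⁺ _ Q!))
diagram (forget j ∷ p) Q p! Q! = forgetDiagram (diagram p _ p! (UniqueDec.deduplicate-! _≟ᴱ_ _))

-- Realising a program as an OBDD

record Realised (m : ℕ) (p : Prog) : Set where
  field
    obdd     : OBDD
    size≤    : size obdd ≤ 2 ^ m * length (reads p)
    VarZ⊆    : ∀ {x} → OBDD.VarZ obdd x → x ∈ reads p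
    computes : ∀ a → OBDD.Computes obdd a ⇔ T (evalCNF a (checks p))
    full     : (∀ {x} → x ∈ reads p → OBDD.VarZ obdd x) ⊎ (∀ a → ¬ T (evalCNF a (checks p)))

realise : ∀ {m} p → Unique (reads p) → Fits m [] p → Realised m p
realise {m} p p! fits = record
  { obdd     = Z
  ; size≤    = D.bound m fits λ where (here refl) → refl
  ; VarZ⊆    = λ where (i , refl) → D.label∈ (name i)
  ; computes = λ a → mk⇔ (λ r → subst T (run-snapshot a [] p fits) (D.sound a start (accepts⁻ a r)))
                         (λ r → accepts⁺ a (D.complete a start (subst T (sym (run-snapshot a [] p fits)) r)))
  ; full     = Sum.map (λ cover x∈ → code (proj₁ (cover x∈)) , trans (cong D.label (name-code _)) (proj₂ (cover x∈)))
                            (λ never a r → never a start (subst T (sym (run-snapshot a [] p fits)) r)) D.full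
  }
  where
  D = diagram p [ [] ] p! ([] ∷ [])
  module D = Diagram D
  start : [] ∈ [ [] ]
  start = here refl
  name : Fin D.count → D.Node
  name = Inverse.to D.Fin↔Node
  code : D.Node → Fin D.count
  code = Inverse.from D.Fin↔Node
  name-code : ∀ i → name (code i) ≡ i
  name-code = Inverse.strictlyInverseˡ D.Fin↔Node
  code-name : ∀ i → code (name i) ≡ i
  code-name = Inverse.strictlyInverseʳ D.Fin↔Node
  next : Bool → Fin D.count → Target D.count
  next b i = map₁ code (D.next b (name i))

  reach : ∀ {t u} → Path D.label D.next t u → Reach (next false) (next true) (map₁ code t) (map₁ code u)
  reach stop             = here _
  reach (step false i r) = viaLo (code i) _
    (subst (λ j → Reach _ _ (map₁ code (D.next false j)) _) (sym (name-code i)) (reach r))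
  reach (step true i r)  = viaHi (code i) _
    (subst (λ j → Reach _ _ (map₁ code (D.next true j)) _) (sym (name-code i)) (reach r))

  code-image : ∀ {t : D.Node ⊎ Bool} {j} → map₁ code t ≡ inj₁ j → t ≡ inj₁ (name j)
  code-image {inj₁ i} refl = cong inj₁ (sym (name-code i))

  ordered : ∀ b i j → next b i ≡ inj₁ j →
            rankIn (reads p) (D.label (name i)) < rankIn (reads p) (D.label (name j))
  ordered b i j eq = D.ordered b (name i) (name j) (code-image eq)

  Z : OBDD
  Z = record
    { size       = D.count
    ; label      = D.label ∘ name
    ; lo         = next false
    ; hi         = next true
    ; source     = map₁ code (D.enter start)
    ; reachable  = reachable
    ; rank       = rankIn (reads p)
    ; rank-inj   = rankIn-injective (reads p)
    ; ordered-lo = ordered false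
    ; ordered-hi = ordered true
    }
    where
    reachable : ∀ i → Reach (next false) (next true) (map₁ code (D.enter start)) (inj₁ i)
    reachable i with D.reached (name i)
    ... | _ , here refl , r = subst (λ i → Reach _ _ _ (inj₁ i)) (code-name i) (reach r)

  accepts⁺ : ∀ a {t} → Accepting D.label D.next a t → OBDD.Accepts Z a (map₁ code t)
  accepts⁺ a accept     = OBDD.atTrue
  accepts⁺ a (step i r) with a (D.label i) in eq
  ... | false = OBDD.goLo (code i) (trans (cong (a ∘ D.label) (name-code i)) eq)
                  (subst (λ j → OBDD.Accepts Z a (map₁ code (D.next false j))) (sym (name-code i)) (accepts⁺ a r))
  ... | true  = OBDD.goHi (code i) (trans (cong (a ∘ D.label) (name-code i)) eq)
                  (subst (λ j → OBDD.Accepts Z a (map₁ code (D.next true j))) (sym (name-code i)) (accepts⁺ a r))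

  accepts⁻ : ∀ a {t} → OBDD.Accepts Z a (map₁ code t) → Accepting D.label D.next a t
  accepts⁻ a r = go refl r
    where
    go : ∀ {t u} → map₁ code t ≡ u → OBDD.Accepts Z a u → Accepting D.label D.next a t
    go {inj₂ true} refl OBDD.atTrue = accept
    go {inj₁ i} refl (OBDD.goLo _ eq r) = step i (go (cong (map₁ code)
      (cong₂ D.next (trans (sym (cong (a ∘ D.label) (name-code i))) eq) (sym (name-code i)))) r)
    go {inj₁ i} refl (OBDD.goHi _ eq r) = step i (go (cong (map₁ code)
      (cong₂ D.next (trans (sym (cong (a ∘ D.label) (name-code i))) eq) (sym (name-code i)))) r)

-- From two programs to a pair of OBDDs

module ++-Solver {A : Set} = CommutativeMonoidSolver (++-commutativeMonoid {A = A})

Unique-resp-↭ : {xs ys : List A} → xs ↭ ys → Unique xs → Unique ys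
Unique-resp-↭ = ↭ₛ.Unique-resp-↭ (setoid _) ∘ ↭⇒↭ₛ

sat⁺ : ∀ {a} Φ → T (evalCNF a Φ) → ∀ {C} → C ∈ Φ → T (any (evalLit a) C)
sat⁺ Φ sat = All.lookup (All.all⁺ _ Φ sat)

sat⁻ : ∀ {a} Φ → (∀ {C} → C ∈ Φ → T (any (evalLit a) C)) → T (evalCNF a Φ)
sat⁻ Φ sat = All.all⁻ _ (All.tabulate sat)

-- Memory is empty before every read, so this fits with `m` = 0 and gives one node per variable at
-- most. It serves for clauses over a single variable and, with no clauses at all, as a program that
-- accepts everything and still mentions every variable.
scan : (ℕ → CNF) → List ℕ → Prog
scan Ψ []       = []
scan Ψ (x ∷ xs) = read x ∷ check (Ψ x) ∷ forget 1 ∷ scan Ψ xs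

reads-scan : ∀ Ψ xs → reads (scan Ψ xs) ≡ xs
reads-scan Ψ []       = refl
reads-scan Ψ (x ∷ xs) = cong (x ∷_) (reads-scan Ψ xs)

checks-scan : ∀ Ψ xs → checks (scan Ψ xs) ≡ concatMap Ψ xs
checks-scan Ψ []       = refl
checks-scan Ψ (x ∷ xs) = cong (Ψ x ++_) (checks-scan Ψ xs)

Fits-scan : ∀ {Ψ} m xs → (∀ {x C} → x ∈ xs → C ∈ Ψ x → map var C ⊆ [ x ]) → Fits m [] (scan Ψ xs)
Fits-scan m []       Ψ⊆ = tt
Fits-scan m (x ∷ xs) Ψ⊆ = z≤n , Ψ⊆ (here refl) , Fits-scan m xs (Ψ⊆ ∘ there)

module _ (φ : CNF) {m : ℕ} (p₁ p₂ : Prog) (fits₁ : Fits m [] p₁) (fits₂ : Fits m [] p₂)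
         (reads₁ : reads p₁ ↭ Vars φ) (reads₂ : reads p₂ ↭ Vars φ)
         (φ⊆ : φ ⊆ checks p₁ ++ checks p₂) (φ⊇ : checks p₁ ++ checks p₂ ⊆ φ) where

  private
    Vars! : Unique (Vars φ)
    Vars! = UniqueDec.deduplicate-! _≟_ _

  represents : Σ OBDD λ Z₁ → Σ OBDD λ Z₂ → Represents φ Z₁ Z₂ ×
               size Z₁ ≤ 2 ^ m * nvars φ × size Z₂ ≤ 2 ^ m * nvars φ
  represents = pair R₁.full
    where
    R₁ = realise p₁ (Unique-resp-↭ (↭-sym reads₁) Vars!) fits₁
    R₂ = realise p₂ (Unique-resp-↭ (↭-sym reads₂) Vars!) fits₂
    idle : Prog
    idle = scan (λ _ → []) (Vars φ)
    reads-idle = reads-scan (λ _ → []) (Vars φ)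
    idle-sat : ∀ xs a → T (evalCNF a (checks (scan (λ _ → []) xs)))
    idle-sat []       a = tt
    idle-sat (x ∷ xs) a = idle-sat xs a
    R₀ = realise idle (subst Unique (sym reads-idle) Vars!) (Fits-scan m (Vars φ) λ _ ())
    module R₀ = Realised R₀
    module R₁ = Realised R₁
    module R₂ = Realised R₂

    sized : ∀ {n} p → n ≤ 2 ^ m * length (reads p) → reads p ↭ Vars φ → n ≤ 2 ^ m * nvars φ
    sized {n} p n≤ p↭ = subst (λ l → n ≤ 2 ^ m * l) (↭-length p↭) n≤

    sat₁ : ∀ {a} → T (evalCNF a φ) → T (evalCNF a (checks p₁))
    sat₁ sat = sat⁻ (checks p₁) (sat⁺ φ sat ∘ φ⊇ ∘ ∈-++⁺ˡ)
    sat₂ : ∀ {a} → T (evalCNF a φ) → T (evalCNF a (checks p₂))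
    sat₂ sat = sat⁻ (checks p₂) (sat⁺ φ sat ∘ φ⊇ ∘ ∈-++⁺ʳ (checks p₁))

    idle-full : (∀ {x} → x ∈ reads idle → OBDD.VarZ R₀.obdd x) ⊎ _ → ∀ {x} → x ∈ Vars φ → OBDD.VarZ R₀.obdd x
    idle-full (inj₁ cover) x∈ = cover (subst (_ ∈_) (sym reads-idle) x∈)
    idle-full (inj₂ never) _  = contradiction (idle-sat (Vars φ) (λ _ → true)) (never _)

    -- A program that always rejects need not reach all its reads; the other OBDD then
    -- only has to mention the variables.
    pair : _ → _
    pair (inj₁ cover) = R₁.obdd , R₂.obdd ,
      ( (λ x x∈ → inj₁ (cover (∈-resp-↭ (↭-sym reads₁) x∈)))
      , (λ x → ∈-resp-↭ reads₁ ∘ R₁.VarZ⊆)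
      , (λ x → ∈-resp-↭ reads₂ ∘ R₂.VarZ⊆)
      , (λ a → mk⇔ (λ sat → Equivalence.from (R₁.computes a) (sat₁ sat) , Equivalence.from (R₂.computes a) (sat₂ sat))
                   (λ (c₁ , c₂) → sat⁻ φ (Sum.[ sat⁺ _ (Equivalence.to (R₁.computes a) c₁)
                                              , sat⁺ _ (Equivalence.to (R₂.computes a) c₂) ]
                                          ∘ ∈-++⁻ (checks p₁) ∘ φ⊆))))
      , sized p₁ R₁.size≤ reads₁ , sized p₂ R₂.size≤ reads₂
    pair (inj₂ never) = R₁.obdd , R₀.obdd ,
      ( (λ x → inj₂ ∘ idle-full R₀.full)
      , (λ x → ∈-resp-↭ reads₁ ∘ R₁.VarZ⊆)
      , (λ x → subst (x ∈_) reads-idle ∘ R₀.VarZ⊆)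
      , (λ a → mk⇔ (λ sat → contradiction (sat₁ sat) (never a))
                   (λ (c₁ , _) → contradiction (Equivalence.to (R₁.computes a) c₁) (never a))))
      , sized p₁ R₁.size≤ reads₁ , sized idle R₀.size≤ (↭-reflexive reads-idle)

-- Tree partitions

-- A forest of bags with, at each of them, clauses over that bag and its parent.
data Partition : Set where
  []   : Partition
  node : List ℕ → CNF → Partition → Partition → Partition

-- The arguments swap on each step down, so `f` acts at even and `g` at odd depth: one fold
-- describes what the centres and the leaves of the stars contribute.
gather : (f g : List ℕ → CNF → List A) → Partition → List A
gather f g []                = []
gather f g (node R Φ ch sib) = f R Φ ++ gather g f ch ++ gather f g sib

vars : Partition → List ℕ
vars = gather (λ R Φ → R) (λ R Φ → R)

clauses : Partition → CNF
clauses = gather (λ R Φ → Φ) (λ R Φ → Φ)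

Below : ℕ → List ℕ → Partition → Set
Below W P []                  = ⊤
Below W P (node R Φ ch sib) =
  length R ≤ W × (∀ {C} → C ∈ Φ → map var C ⊆ P ++ R) × Below W R ch × Below W P sib

-- Reading a tree partition star by star

readAll : List ℕ → Prog → Prog
readAll []      k = k
readAll (x ∷ R) k = read x ∷ readAll R k

leaves : Partition → Prog → Prog
leaves []                k = k
leaves (node R Φ ch sib) k = readAll R (check Φ ∷ forget (length R) ∷ leaves sib k)

-- stars checks the clauses between a bag at even depth and its children.
mutual
  stars : Partition → Prog → Prog
  stars []                k = k
  stars (node R Φ ch sib) k = readAll R (leaves ch (forget (length R) ∷ starsBelow ch (stars sib k)))

  -- The roots have just been read as leaves, so the next centres are their children.
  starsBelow : Partition → Prog → Prog
  starsBelow []                k = k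
  starsBelow (node R Φ ch sib) k = stars ch (starsBelow sib k)

drop-ʳ++ : (R L : List A) → drop (length R) (R ʳ++ L) ≡ L
drop-ʳ++ []      L = refl
drop-ʳ++ (x ∷ R) L = trans (drop-suc (length R) (R ʳ++ (x ∷ L))) (cong (drop 1) (drop-ʳ++ R (x ∷ L)))
  where
  drop-suc : ∀ n (xs : List A) → drop (suc n) xs ≡ drop 1 (drop n xs)
  drop-suc zero    xs       = refl
  drop-suc (suc n) []       = refl
  drop-suc (suc n) (x ∷ xs) = drop-suc n xs

∈-ʳ++⁺ : ∀ {x : A} R {L} → x ∈ R ⊎ x ∈ L → x ∈ R ʳ++ L
∈-ʳ++⁺ R {L} = ∈-resp-↭ (++↭ʳ++ R L) ∘ Sum.[ ∈-++⁺ˡ , ∈-++⁺ʳ R ]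

module _ {W : ℕ} where

  private
    m = W + W

  Fits-readAll : ∀ R k {L} → length R + length L ≤ m → Fits m (R ʳ++ L) k → Fits m L (readAll R k)
  Fits-readAll []      k _  fits = fits
  Fits-readAll (x ∷ R) k ≤m fits =
    m+n≤o⇒n≤o (suc (length R)) ≤m , Fits-readAll R k (≤-trans (≤-reflexive (+-suc (length R) _)) ≤m) fits

  Fits-forget : ∀ R k {L} → Fits m L k → Fits m (R ʳ++ L) (forget (length R) ∷ k)
  Fits-forget R k {L} fits = subst (λ L → Fits m L k) (sym (drop-ʳ++ R L)) fits

  -- The centre stays at the bottom of the stack while each leaf is put on top of it and dropped
  -- again. Hence memory for two bags is enough.
  Fits-leaves : ∀ {P L} F k → Below W P F → P ⊆ L → length L ≤ W → Fits m L k → Fits m L (leaves F k)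
  Fits-leaves         []                k _                      P⊆L L≤W fits = fits
  Fits-leaves {P} {L} (node R Φ ch sib) k (R≤W , Φ⊆ , _ , below) P⊆L L≤W fits =
    Fits-readAll R (check Φ ∷ forget (length R) ∷ leaves sib k) (+-mono-≤ R≤W L≤W)
      ( (λ C∈ x∈ → ∈-ʳ++⁺ R (Sum.swap (Sum.map₁ P⊆L (∈-++⁻ P (Φ⊆ C∈ x∈)))))
      , Fits-forget R (leaves sib k) (Fits-leaves sib k below P⊆L L≤W fits))

  mutual
    Fits-stars : ∀ {P} F k → Below W P F → Fits m [] k → Fits m [] (stars F k)
    Fits-stars []                k _                           fits = fits
    Fits-stars (node R Φ ch sib) k (R≤W , _ , belowᶜ , belowˢ) fits =
      Fits-readAll R _ (≤-trans (≤-reflexive (+-identityʳ _)) (m≤n⇒m≤n+o W R≤W))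
        (Fits-leaves ch _ belowᶜ (λ x∈ → ∈-ʳ++⁺ R (inj₁ x∈))
          (≤-trans (≤-reflexive (trans (sym (↭-length (++↭ʳ++ R []))) (cong length (++-identityʳ R)))) R≤W)
          (Fits-forget R (starsBelow ch (stars sib k))
            (Fits-starsBelow ch (stars sib k) belowᶜ (Fits-stars sib k belowˢ fits))))

    Fits-starsBelow : ∀ {P} F k → Below W P F → Fits m [] k → Fits m [] (starsBelow F k)
    Fits-starsBelow []                k _                         fits = fits
    Fits-starsBelow (node R Φ ch sib) k (_ , _ , belowᶜ , belowˢ) fits =
      Fits-stars ch _ belowᶜ (Fits-starsBelow sib k belowˢ fits)

-- Used with `out` = `reads`, where centre and leaf both contribute their bag, and with `out` =
-- `checks`, where only leaves contribute. The order in which stars are visited differs from that of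
-- the partition, hence permutations.
module _ (out : Prog → List A) (centre : List ℕ → CNF → List A) (leaf : List ℕ → CNF → List A)
         (out-forget : ∀ j k → out (forget j ∷ k) ≡ out k)
         (out-centre : ∀ R Φ k → out (readAll R k) ≡ centre R Φ ++ out k)
         (out-leaf : ∀ R Φ k → out (readAll R (check Φ ∷ k)) ≡ leaf R Φ ++ out k)
  where

  open ++-Solver
  open PermutationReasoning

  private
    roots : Partition → List A
    roots []                = []
    roots (node R Φ ch sib) = leaf R Φ ++ roots sib

    rest : Partition → List A
    rest []                = []
    rest (node R Φ ch sib) = gather centre leaf ch ++ rest sib

    gather↭roots++rest : ∀ F → gather leaf centre F ↭ roots F ++ rest F
    gather↭roots++rest []                = ↭-refl
    gather↭roots++rest (node R Φ ch sib) = begin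
      leaf R Φ ++ gather centre leaf ch ++ gather leaf centre sib
        ↭⟨ ++⁺ˡ (leaf R Φ) (++⁺ˡ (gather centre leaf ch) (gather↭roots++rest sib)) ⟩
      leaf R Φ ++ gather centre leaf ch ++ roots sib ++ rest sib
        ↭⟨ solve 4 (λ a b c d → a ⊕ b ⊕ c ⊕ d ⊜ (a ⊕ c) ⊕ b ⊕ d) ↭-refl
             (leaf R Φ) (gather centre leaf ch) (roots sib) (rest sib) ⟩
      (leaf R Φ ++ roots sib) ++ gather centre leaf ch ++ rest sib ∎

    out-leaves′ : ∀ F k → out (leaves F k) ≡ roots F ++ out k
    out-leaves′ []                k = ≡.refl
    out-leaves′ (node R Φ ch sib) k = ≡.trans (out-leaf R Φ _) (≡.trans
      (≡.cong (leaf R Φ ++_) (≡.trans (out-forget (length R) _) (out-leaves′ sib k)))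
      (≡.sym (++-assoc (leaf R Φ) _ _)))

  mutual
    out-stars : ∀ F k → out (stars F k) ↭ gather centre leaf F ++ out k
    out-stars []                k = ↭-refl
    out-stars (node R Φ ch sib) k = begin
      out (readAll R (leaves ch (forget (length R) ∷ starsBelow ch (stars sib k))))
        ≡⟨ out-centre R Φ _ ⟩
      centre R Φ ++ out (leaves ch (forget (length R) ∷ starsBelow ch (stars sib k)))
        ≡⟨ ≡.cong (centre R Φ ++_) (≡.trans (out-leaves′ ch _) (≡.cong (roots ch ++_) (out-forget _ _))) ⟩
      centre R Φ ++ roots ch ++ out (starsBelow ch (stars sib k))
        ↭⟨ ++⁺ˡ (centre R Φ) (++⁺ˡ (roots ch) (↭-trans (out-starsBelow ch _) (++⁺ˡ (rest ch) (out-stars sib k)))) ⟩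
      centre R Φ ++ roots ch ++ rest ch ++ gather centre leaf sib ++ out k
        ↭⟨ solve 5 (λ a b c d e → a ⊕ b ⊕ c ⊕ d ⊕ e ⊜ (a ⊕ (b ⊕ c) ⊕ d) ⊕ e) ↭-refl
             (centre R Φ) (roots ch) (rest ch) (gather centre leaf sib) (out k) ⟩
      (centre R Φ ++ (roots ch ++ rest ch) ++ gather centre leaf sib) ++ out k
        ↭⟨ ++⁺ʳ (out k) (++⁺ˡ (centre R Φ) (++⁺ʳ (gather centre leaf sib) (gather↭roots++rest ch))) ⟨
      (centre R Φ ++ gather leaf centre ch ++ gather centre leaf sib) ++ out k ∎

    out-starsBelow : ∀ F k → out (starsBelow F k) ↭ rest F ++ out k
    out-starsBelow []                k = ↭-refl
    out-starsBelow (node R Φ ch sib) k = begin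
      out (stars ch (starsBelow sib k))                ↭⟨ out-stars ch _ ⟩
      gather centre leaf ch ++ out (starsBelow sib k)  ↭⟨ ++⁺ˡ (gather centre leaf ch) (out-starsBelow sib k) ⟩
      gather centre leaf ch ++ rest sib ++ out k       ≡⟨ ++-assoc (gather centre leaf ch) _ _ ⟨
      (gather centre leaf ch ++ rest sib) ++ out k     ∎

  out-leaves : ∀ F k → out (leaves F (starsBelow F k)) ↭ gather leaf centre F ++ out k
  out-leaves F k = begin
    out (leaves F (starsBelow F k))    ≡⟨ out-leaves′ F _ ⟩
    roots F ++ out (starsBelow F k)    ↭⟨ ++⁺ˡ (roots F) (out-starsBelow F k) ⟩
    roots F ++ rest F ++ out k         ≡⟨ ++-assoc (roots F) _ _ ⟨
    (roots F ++ rest F) ++ out k       ↭⟨ ++⁺ʳ (out k) (gather↭roots++rest F) ⟨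
    gather leaf centre F ++ out k      ∎

reads-readAll : ∀ R k → reads (readAll R k) ≡ R ++ reads k
reads-readAll []      k = refl
reads-readAll (x ∷ R) k = cong (x ∷_) (reads-readAll R k)

checks-readAll : ∀ R k → checks (readAll R k) ≡ checks k
checks-readAll []      k = refl
checks-readAll (x ∷ R) k = checks-readAll R k

gather-alternate : ∀ F → gather (λ _ _ → []) (λ R Φ → Φ) F ++ gather (λ R Φ → Φ) (λ _ _ → []) F ↭ clauses F
gather-alternate []                = ↭-refl
gather-alternate (node R Φ ch sib) = ↭-trans
  (solve 5 (λ a b c d e → (a ⊕ b) ⊕ c ⊕ d ⊕ e ⊜ c ⊕ (d ⊕ a) ⊕ b ⊕ e) ↭-refl
     (gather Φs ∅ ch) (gather ∅ Φs sib) Φ (gather ∅ Φs ch) (gather Φs ∅ sib))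
  (++⁺ˡ Φ (++⁺ (gather-alternate ch) (gather-alternate sib)))
  where
  open ++-Solver
  ∅ Φs : List ℕ → CNF → CNF
  ∅  _ _ = []
  Φs R Φ = Φ

partition-represents : ∀ {φ W} F → Below W [] F → vars F ↭ Vars φ → φ ⊆ clauses F → clauses F ⊆ φ →
  Σ OBDD λ Z₁ → Σ OBDD λ Z₂ → Represents φ Z₁ Z₂ ×
  size Z₁ ≤ 2 ^ (W + W) * nvars φ × size Z₂ ≤ 2 ^ (W + W) * nvars φ
partition-represents {φ} {W} F below vars↭ φ⊆ ⊆φ = represents φ p₁ p₂
  (Fits-stars F [] below tt)
  (Fits-leaves F _ below id z≤n (Fits-starsBelow F [] below tt))
  (reads↭ (out-stars reads _ _ (λ _ _ → refl) (λ R _ → reads-readAll R) (λ R _ _ → reads-readAll R _) F []))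
  (reads↭ (out-leaves reads _ _ (λ _ _ → refl) (λ R _ → reads-readAll R) (λ R _ _ → reads-readAll R _) F []))
  (∈-resp-↭ (↭-sym checks↭) ∘ φ⊆) (⊆φ ∘ ∈-resp-↭ checks↭)
  where
  p₁ = stars F []
  -- For the other parity the roots are leaves of a star with an empty centre, and the bags at odd
  -- depth become the centres.
  p₂ = leaves F (starsBelow F [])
  drop-++[] : {xs ys : List A} → xs ↭ ys ++ [] → xs ↭ ys
  drop-++[] xs↭ = ↭-trans xs↭ (↭-reflexive (++-identityʳ _))
  reads↭ : ∀ {xs} → xs ↭ vars F ++ [] → xs ↭ Vars φ
  reads↭ xs↭ = ↭-trans (drop-++[] xs↭) vars↭
  ∅ Φs : List ℕ → CNF → CNF
  ∅  _ _ = []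
  Φs _ Φ = Φ
  checks↭ : checks p₁ ++ checks p₂ ↭ clauses F
  checks↭ = ↭-trans (++⁺
    (drop-++[] (out-stars checks ∅ Φs (λ _ _ → refl) (λ R _ → checks-readAll R) (λ R _ _ → checks-readAll R _) F []))
    (drop-++[] (out-leaves checks ∅ Φs (λ _ _ → refl) (λ R _ → checks-readAll R) (λ R _ _ → checks-readAll R _) F [])))
    (gather-alternate F)

-- Forests of nested bags

∈-concatMap : (f : A → List B) {t : A} {ts : List A} {v : B} → t ∈ ts → v ∈ f t → v ∈ concatMap f ts
∈-concatMap f t∈ v∈ = ∈-concatMap⁺ f (lose t∈ v∈)

length-concatMap≤ : (f : A → List B) {b : ℕ} (ts : List A) → (∀ {t} → t ∈ ts → length (f t) ≤ b) →
                    length (concatMap f ts) ≤ length ts * b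
length-concatMap≤ f []       f≤ = z≤n
length-concatMap≤ f (t ∷ ts) f≤ =
  ≤-trans (≤-reflexive (length-++ (f t))) (+-mono-≤ (f≤ (here refl)) (length-concatMap≤ f ts (f≤ ∘ there)))

Unique-++⁻ : ∀ (xs : List A) {ys} → Unique (xs ++ ys) → Unique xs × Unique ys × (∀ {v} → v ∈ xs → v ∉ ys)
Unique-++⁻ []       u        = [] , u , λ ()
Unique-++⁻ (x ∷ xs) (x∉ ∷ u) = let xs! , ys! , dis = Unique-++⁻ xs u in
  All.++⁻ˡ xs x∉ ∷ xs! , ys! , λ where
    (here refl) v∈ys → All.lookup (All.++⁻ʳ xs x∉) v∈ys refl
    (there v∈)  v∈ys → dis v∈ v∈ys

filter-split-↭ : {P : A → Set} (P? : Decidable P) (xs : List A) → xs ↭ filter P? xs ++ filter (¬? ∘ P?) xs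
filter-split-↭ P? []       = ↭-refl
filter-split-↭ P? (x ∷ xs) with P? x
... | yes _ = prep x (filter-split-↭ P? xs)
... | no  _ = ↭-trans (prep x (filter-split-↭ P? xs)) (↭-sym (shift x (filter P? xs) _))

data Forest (A : Set) : Set where
  []   : Forest A
  node : A → (children siblings : Forest A) → Forest A

flat : (A → List B) → Forest A → List B
flat f []              = []
flat f (node t ch sib) = f t ++ flat f ch ++ flat f sib

_∪ᶠ_ : Forest A → Forest A → Forest A
[]            ∪ᶠ G = G
node t ch sib ∪ᶠ G = node t ch (sib ∪ᶠ G)

flat-∪ : (f : A → List B) (F G : Forest A) → flat f (F ∪ᶠ G) ≡ flat f F ++ flat f G
flat-∪ f []              G = refl
flat-∪ f (node t ch sib) G rewrite flat-∪ f sib G | ++-assoc (f t) (flat f ch ++ flat f sib) (flat f G)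
  | ++-assoc (flat f ch) (flat f sib) (flat f G) = refl

flat-filter : {P : B → Set} (P? : Decidable P) (f : A → List B) (F : Forest A) →
              flat (filter P? ∘ f) F ≡ filter P? (flat f F)
flat-filter P? f []              = refl
flat-filter P? f (node t ch sib)
  rewrite filter-++ P? (f t) (flat f ch ++ flat f sib) | filter-++ P? (flat f ch) (flat f sib)
        | flat-filter P? f ch | flat-filter P? f sib = refl

-- The inclusion is stated for every `g` because a node found through one of its clauses is
-- afterwards used through its bag.
flat-find : (f : A → List B) (F : Forest A) {y : B} → y ∈ flat f F →
            ∃ λ t → y ∈ f t × (∀ {C : Set} (g : A → List C) → g t ⊆ flat g F)
flat-find f (node t ch sib) y∈ with ∈-++⁻ (f t) y∈
... | inj₁ y∈t = t , y∈t , λ g → ∈-++⁺ˡ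
... | inj₂ y∈′ with ∈-++⁻ (flat f ch) y∈′
... | inj₁ y∈ch  = let u , y∈u , sub = flat-find f ch y∈ch in
                   u , y∈u , λ g → ∈-++⁺ʳ (g t) ∘ ∈-++⁺ˡ ∘ sub g
... | inj₂ y∈sib = let u , y∈u , sub = flat-find f sib y∈sib in
                   u , y∈u , λ g → ∈-++⁺ʳ (g t) ∘ ∈-++⁺ʳ (flat g ch) ∘ sub g

-- A bag is split into the part inherited from the parent's bag and the part that is new
-- at this node; each clause is kept at one node whose bag contains it.
record Bags (A : Set) : Set where
  field
    inh new : A → List ℕ
    cls     : A → CNF

  bag : A → List ℕ
  bag t = inh t ++ new t

  Nested : List ℕ → Forest A → Set
  Nested P []              = ⊤
  Nested P (node t ch sib) = inh t ⊆ P × Nested (bag t) ch × Nested P sib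

  Nested-mono : ∀ {P Q} F → P ⊆ Q → Nested P F → Nested Q F
  Nested-mono []              P⊆Q _              = tt
  Nested-mono (node t ch sib) P⊆Q (i , nᶜ , nˢ) = P⊆Q ∘ i , nᶜ , Nested-mono sib P⊆Q nˢ

  Nested-∪ : ∀ {P} F {G} → Nested P F → Nested P G → Nested P (F ∪ᶠ G)
  Nested-∪ []              _              n = n
  Nested-∪ (node t ch sib) (i , nᶜ , nˢ) n = i , nᶜ , Nested-∪ sib nˢ n

  flat-bag⊆ : ∀ {P} F → Nested P F → ∀ {v} → v ∈ flat bag F → v ∈ P ⊎ v ∈ flat new F
  flat-bag⊆ (node t ch sib) (i , nᶜ , nˢ) v∈ with ∈-++⁻ (bag t) v∈
  ... | inj₁ v∈t = Sum.map i ∈-++⁺ˡ (∈-++⁻ (inh t) v∈t)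
  ... | inj₂ v∈′ with ∈-++⁻ (flat bag ch) v∈′
  ... | inj₂ v∈sib = Sum.map₂ (∈-++⁺ʳ (new t) ∘ ∈-++⁺ʳ (flat new ch)) (flat-bag⊆ sib nˢ v∈sib)
  ... | inj₁ v∈ch with flat-bag⊆ ch nᶜ v∈ch
  ... | inj₁ v∈t = Sum.map i ∈-++⁺ˡ (∈-++⁻ (inh t) v∈t)
  ... | inj₂ v∈n = inj₂ (∈-++⁺ʳ (new t) (∈-++⁺ˡ v∈n))

  Disjoint : List ℕ → Forest A → Set
  Disjoint P F = ∀ {v} → v ∈ P → v ∉ flat new F

-- Cutting a forest at marked nodes

Comp : Set → Set
Comp A = Forest A × List ℕ

flats : (A → List B) → List (Comp A) → List B
flats f = concatMap (flat f ∘ proj₁)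

joined : List (Comp A) → Forest A
joined = foldr (λ c F → proj₁ c ∪ᶠ F) []

flat-joined : (f : A → List B) (cs : List (Comp A)) → flat f (joined cs) ≡ flats f cs
flat-joined f []             = refl
flat-joined f ((F , ρ) ∷ cs) = trans (flat-∪ f F (joined cs)) (cong (flat f F ++_) (flat-joined f cs))

enlarge : List ℕ → Comp A → Comp A
enlarge P (F , ρ) = F , P ++ ρ

flats-enlarge : (f : A → List B) (P : List ℕ) (cs : List (Comp A)) → flats f (map (enlarge P) cs) ≡ flats f cs
flats-enlarge f P = concatMap-map (flat f ∘ proj₁) (enlarge P)

boundary : List (Comp A) → List ℕ
boundary = concatMap proj₂

module Cutting {A : Set} (β : Bags A) (S : List ℕ) where

  open Bags β

  -- A vertex of S is charged to the node where it is new, so it is paid for only once.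
  fresh : A → List ℕ
  fresh t = filter (_∈? S) (new t)

  -- Cut F i d M: cutting F at the nodes M leaves the pending components i, which reach
  -- the roots of F, and the closed components d. The boundary of a component
  -- collects its vertices in S and the bags of the adjacent nodes of M.
  data Cut : Forest A → (i d : List (Comp A)) → List A → Set where
    []   : Cut [] [] [] []
    skip : ∀ {t ch sib i i′ d d′ M M′} → Cut ch i d M → Cut sib i′ d′ M′ →
           Cut (node t ch sib) ((node t (joined i) [] , fresh t ++ boundary i) ∷ i′) (d ++ d′) (M ++ M′)
    mark : ∀ {t ch sib i i′ d d′ M M′} → Cut ch i d M → Cut sib i′ d′ M′ →
           Cut (node t ch sib) (([] , bag t) ∷ i′) (map (enlarge (bag t)) i ++ d ++ d′) (t ∷ M ++ M′)

  cut-↭ : ∀ {B : Set} (f : A → List B) {F i d M} → Cut F i d M → flat f F ↭ flats f i ++ flats f d ++ concatMap f M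
  cut-↭ f [] = ↭-refl
  cut-↭ f (skip {t} {ch} {sib} {i} {i′} {d} {d′} {M} {M′} c c′)
    rewrite flat-joined f i | concatMap-++ (flat f ∘ proj₁) d d′ | concatMap-++ f M M′ =
    ↭-trans (++⁺ˡ (f t) (++⁺ (cut-↭ f c) (cut-↭ f c′)))
      (solve 7 (λ t i d m i′ d′ m′ → t ⊕ (i ⊕ d ⊕ m) ⊕ (i′ ⊕ d′ ⊕ m′)
                                  ⊜ ((t ⊕ i ⊕ ++-Solver.id) ⊕ i′) ⊕ (d ⊕ d′) ⊕ m ⊕ m′)
        ↭-refl (f t) (flats f i) (flats f d) (concatMap f M) (flats f i′) (flats f d′) (concatMap f M′))
    where open ++-Solver
  cut-↭ f (mark {t} {ch} {sib} {i} {i′} {d} {d′} {M} {M′} c c′)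
    rewrite concatMap-++ (flat f ∘ proj₁) (map (enlarge (bag t)) i) (d ++ d′) | flats-enlarge f (bag t) i
          | concatMap-++ (flat f ∘ proj₁) d d′ | concatMap-++ f M M′ =
    ↭-trans (++⁺ˡ (f t) (++⁺ (cut-↭ f c) (cut-↭ f c′)))
      (solve 7 (λ t i d m i′ d′ m′ → t ⊕ (i ⊕ d ⊕ m) ⊕ (i′ ⊕ d′ ⊕ m′) ⊜ i′ ⊕ (i ⊕ d ⊕ d′) ⊕ t ⊕ m ⊕ m′)
        ↭-refl (f t) (flats f i) (flats f d) (concatMap f M) (flats f i′) (flats f d′) (concatMap f M′))
    where open ++-Solver

  cut-bags⊆ : ∀ {F i d M} → Cut F i d M → concatMap bag M ⊆ flat bag F
  cut-bags⊆ {i = i} {d} c v∈ = ∈-resp-↭ (↭-sym (cut-↭ bag c)) (∈-++⁺ʳ (flats bag i) (∈-++⁺ʳ (flats bag d) v∈))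

  cut-pending⊆ : ∀ {F i d M} → Cut F i d M → flats new i ⊆ flat new F
  cut-pending⊆ c v∈ = ∈-resp-↭ (↭-sym (cut-↭ new c)) (∈-++⁺ˡ v∈)

  cut-closed⊆ : ∀ {F i d M} → Cut F i d M → flats new d ⊆ flat new F
  cut-closed⊆ {i = i} c v∈ = ∈-resp-↭ (↭-sym (cut-↭ new c)) (∈-++⁺ʳ (flats new i) (∈-++⁺ˡ v∈))

  joined-nested : ∀ {P i} → All (Nested P ∘ proj₁) i → Nested P (joined i)
  joined-nested []       = tt
  joined-nested (n ∷ ns) = Nested-∪ _ n (joined-nested ns)

  -- A pending component still hangs below `P`. A closed one hangs below the mark that closed it,
  -- and the bag of that mark was put into its boundary.
  cut-nested : ∀ {P F i d M} → Cut F i d M → Nested P F →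
               All (Nested P ∘ proj₁) i × All (λ (G , ρ) → Nested ρ G) d
  cut-nested []          _              = [] , []
  cut-nested (skip c c′) (i , nᶜ , nˢ) = let is , ds = cut-nested c nᶜ ; is′ , ds′ = cut-nested c′ nˢ in
    (i , joined-nested is , tt) ∷ is′ , All.++⁺ ds ds′
  cut-nested (mark c c′) (i , nᶜ , nˢ) = let is , ds = cut-nested c nᶜ ; is′ , ds′ = cut-nested c′ nˢ in
    tt ∷ is′ , All.++⁺ (All.map⁺ (All.map (λ {(G , ρ)} → Nested-mono G ∈-++⁺ˡ) is)) (All.++⁺ ds ds′)

  Cutset : List A → List ℕ
  Cutset M = S ++ concatMap bag M

  Cutset-mono : ∀ M {N} → M ⊆ N → Cutset M ⊆ Cutset N
  Cutset-mono M M⊆N v∈ with ∈-++⁻ S v∈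
  ... | inj₁ v∈S = ∈-++⁺ˡ v∈S
  ... | inj₂ v∈M = let t , t∈ , v∈t = find (∈-concatMap⁻ bag {xs = M} v∈M) in ∈-++⁺ʳ S (∈-concatMap bag (M⊆N t∈) v∈t)

  WithinCutset : List A → List (Comp A) → Set
  WithinCutset M = All ((_⊆ Cutset M) ∘ proj₂)

  within-mono : ∀ M N {cs} → M ⊆ N → WithinCutset M cs → WithinCutset N cs
  within-mono M N M⊆N = All.map λ ρ⊆ {v} v∈ → Cutset-mono M M⊆N (ρ⊆ v∈)

  cut-within : ∀ {F i d M} → Cut F i d M → WithinCutset M i × WithinCutset M d
  cut-within []          = [] , []
  cut-within (skip {t} {i = i} {M = M} {M′} c c′) =
    top ∷ within-mono M′ (M ++ M′) (∈-++⁺ʳ M) is′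
    , All.++⁺ (within-mono M (M ++ M′) ∈-++⁺ˡ ds) (within-mono M′ (M ++ M′) (∈-++⁺ʳ M) ds′)
    where
    is = proj₁ (cut-within c) ; ds = proj₂ (cut-within c) ; is′ = proj₁ (cut-within c′) ; ds′ = proj₂ (cut-within c′)
    top : fresh t ++ boundary i ⊆ Cutset (M ++ M′)
    top v∈ with ∈-++⁻ (fresh t) v∈
    ... | inj₁ v∈t = ∈-++⁺ˡ (proj₂ (∈-filter⁻ (_∈? S) {xs = new t} v∈t))
    ... | inj₂ v∈i = let c , c∈ , v∈c = find (∈-concatMap⁻ proj₂ {xs = i} v∈i) in
                     Cutset-mono M ∈-++⁺ˡ (All.lookup is c∈ v∈c)
  cut-within (mark {t} {i = i} {M = M} {M′} c c′) =
    (λ v∈ → ∈-++⁺ʳ S (∈-++⁺ˡ v∈)) ∷ within-mono M′ (t ∷ M ++ M′) (there ∘ ∈-++⁺ʳ M) is′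
    , All.++⁺ (All.map⁺ (All.tabulate λ c∈ {v} → enlarged (All.lookup is c∈)))
      (All.++⁺ (within-mono M (t ∷ M ++ M′) (there ∘ ∈-++⁺ˡ) ds)
               (within-mono M′ (t ∷ M ++ M′) (there ∘ ∈-++⁺ʳ M) ds′))
    where
    is = proj₁ (cut-within c) ; ds = proj₂ (cut-within c) ; is′ = proj₁ (cut-within c′) ; ds′ = proj₂ (cut-within c′)
    enlarged : ∀ {ρ} → ρ ⊆ Cutset M → bag t ++ ρ ⊆ Cutset (t ∷ M ++ M′)
    enlarged ρ⊆ v∈ with ∈-++⁻ (bag t) v∈
    ... | inj₁ v∈t = ∈-++⁺ʳ S (∈-++⁺ˡ v∈t)
    ... | inj₂ v∈ρ = Cutset-mono M (there ∘ ∈-++⁺ˡ) (ρ⊆ v∈ρ)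

  -- Connectedness in local form, with `P` the bag above the forest: a vertex is new at no more than
  -- one node, never if it lies in `P`, and any other bag that holds it inherits it from the bag
  -- directly above.
  record Proper (P : List ℕ) (F : Forest A) : Set where
    constructor proper
    field
      nested   : Nested P F
      unique   : Unique (flat new F)
      disjoint : Disjoint P F

  record Branching (P : List ℕ) (t : A) (ch sib : Forest A) : Set where
    field
      inh⊆   : inh t ⊆ P
      properᶜ : Proper (bag t) ch
      properˢ : Proper P sib
      ∉sib   : ∀ {v} → v ∈ new t ++ flat new ch → v ∉ flat bag sib
      ∉tree  : ∀ {v} → v ∈ flat new sib → v ∉ bag t ++ flat bag ch

  branching : ∀ {P t ch sib} → Proper P (node t ch sib) → Branching P t ch sib
  branching {P} {t} {ch} {sib} (proper (i , nᶜ , nˢ) u d) with Unique-++⁻ (new t) u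
  ... | _ , u′ , t# with Unique-++⁻ (flat new ch) u′
  ... | uᶜ , uˢ , ch# = record
    { inh⊆    = i
    ; properᶜ = proper nᶜ uᶜ (λ v∈ v∈ch → Sum.[ (λ v∈i → d (i v∈i) (∈-++⁺ʳ (new t) (∈-++⁺ˡ v∈ch)))
                                              , (λ v∈t → t# v∈t (∈-++⁺ˡ v∈ch)) ] (∈-++⁻ (inh t) v∈))
    ; properˢ = proper nˢ uˢ (λ v∈P v∈sib → d v∈P (∈-++⁺ʳ (new t) (∈-++⁺ʳ (flat new ch) v∈sib)))
    ; ∉sib    = λ v∈ v∈sib → Sum.[ (λ v∈P → d v∈P (assoc v∈)) , here# v∈ ] (flat-bag⊆ sib nˢ v∈sib)
    ; ∉tree   = λ v∈ v∈′ → Sum.[ tree# v∈ , below# v∈ ] (∈-++⁻ (bag t) v∈′)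
    }
    where
    assoc : ∀ {v} → v ∈ new t ++ flat new ch → v ∈ new t ++ flat new ch ++ flat new sib
    assoc v∈ = Sum.[ ∈-++⁺ˡ , ∈-++⁺ʳ (new t) ∘ ∈-++⁺ˡ ] (∈-++⁻ (new t) v∈)
    here# : ∀ {v} → v ∈ new t ++ flat new ch → v ∉ flat new sib
    here# v∈ v∈sib = Sum.[ (λ v∈t → t# v∈t (∈-++⁺ʳ (flat new ch) v∈sib))
                         , (λ v∈ch → ch# v∈ch v∈sib) ] (∈-++⁻ (new t) v∈)
    tree# : ∀ {v} → v ∈ flat new sib → v ∉ bag t
    tree# v∈ v∈t = Sum.[ (λ v∈i → d (i v∈i) (∈-++⁺ʳ (new t) (∈-++⁺ʳ (flat new ch) v∈)))
                       , (λ v∈n → t# v∈n (∈-++⁺ʳ (flat new ch) v∈)) ] (∈-++⁻ (inh t) v∈t)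
    below# : ∀ {v} → v ∈ flat new sib → v ∉ flat bag ch
    below# v∈ v∈ch = Sum.[ tree# v∈ , (λ v∈new → ch# v∈new v∈) ] (flat-bag⊆ ch nᶜ v∈ch)

  ∈-marked-++ : ∀ M {N v} → v ∈ concatMap bag (M ++ N) → v ∈ concatMap bag M ⊎ v ∈ concatMap bag N
  ∈-marked-++ M {N} v∈ = ∈-++⁻ (concatMap bag M) (subst (_ ∈_) (concatMap-++ bag M N) v∈)

  -- A marked bag containing a vertex of the bag P above F has a topmost such marked bag,
  -- which bounds a pending component.
  marked∩above : ∀ {P F i d M} → Cut F i d M → Proper P F → ∀ {v} → v ∈ P → v ∈ concatMap bag M → v ∈ boundary i
  inner : ∀ {P t ch sib i d M} → Cut ch i d M → Branching P t ch sib →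
          ∀ {v} → v ∈ P → v ∉ flat new ch → v ∈ concatMap bag M → v ∈ bag t × v ∈ boundary i

  inner {ch = ch} c br v∈P v∉ v∈M with flat-bag⊆ ch (Proper.nested properᶜ) (cut-bags⊆ c v∈M)
    where open Branching br
  ... | inj₁ v∈t = v∈t , marked∩above c (Branching.properᶜ br) v∈t v∈M
  ... | inj₂ v∈ch = contradiction v∈ch v∉

  marked∩above (skip {t} {M = M} c c′) pr v∈P v∈M with ∈-marked-++ M v∈M
  ... | inj₁ v∈ = ∈-++⁺ˡ (∈-++⁺ʳ (fresh t) (proj₂
    (inner c (branching pr) v∈P (λ v∈ch → Proper.disjoint pr v∈P (∈-++⁺ʳ (new t) (∈-++⁺ˡ v∈ch))) v∈)))
  ... | inj₂ v∈ = ∈-++⁺ʳ _ (marked∩above c′ (Branching.properˢ (branching pr)) v∈P v∈)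
  marked∩above (mark {t} {M = M} c c′) pr v∈P v∈M with ∈-++⁻ (bag t) v∈M
  ... | inj₁ v∈t = ∈-++⁺ˡ v∈t
  ... | inj₂ v∈M′ with ∈-marked-++ M v∈M′
  ... | inj₁ v∈ = ∈-++⁺ˡ (proj₁
    (inner c (branching pr) v∈P (λ v∈ch → Proper.disjoint pr v∈P (∈-++⁺ʳ (new t) (∈-++⁺ˡ v∈ch))) v∈))
  ... | inj₂ v∈ = ∈-++⁺ʳ (bag t) (marked∩above c′ (Branching.properˢ (branching pr)) v∈P v∈)

  -- With `Nested` this makes ρ a boundary in the full sense: a clause of the component that meets
  -- the cutset meets it inside ρ.
  Captured : List A → Comp A → Set
  Captured M (G , ρ) = ∀ {v} → v ∈ flat new G → v ∈ Cutset M → v ∈ ρ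

  -- Further marks could put more vertices of a component into the cutset. The second hypothesis
  -- excludes this; it holds because marks in another branch share no vertices that are new in the
  -- component.
  captured-mono : ∀ M N {cs F} → flats new cs ⊆ F →
                  (∀ {v} → v ∈ F → v ∈ concatMap bag N → v ∈ Cutset M) →
                  All (Captured M) cs → All (Captured N) cs
  captured-mono M N cs⊆ back caps = All.tabulate λ {c} c∈ v∈c v∈N →
    All.lookup caps c∈ v∈c (Sum.[ ∈-++⁺ˡ , back (cs⊆ (∈-concatMap (flat new ∘ proj₁) c∈ v∈c)) ] (∈-++⁻ S v∈N))

  -- The bags that hold a vertex lie at or below the node where it is new. A marked one among them
  -- is therefore separated from that node by a topmost such mark, whose bag is part of the boundary
  -- of the component; marks in sibling trees cannot hold the vertex.
  cut-captured : ∀ {P F i d M} → Cut F i d M → Proper P F → All (Captured M) i × All (Captured M) d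
  cut-captured [] _ = [] , []
  cut-captured {P} {node t ch sib} (skip {i = i} {M = M} {M′ = M′} c c′) pr =
    top ∷ captured-mono M′ (M ++ M′) (cut-pending⊆ c′) right is′
    , All.++⁺ (captured-mono M (M ++ M′) (cut-closed⊆ c) left ds)
              (captured-mono M′ (M ++ M′) (cut-closed⊆ c′) right ds′)
    where
    open Branching (branching pr)
    caps  = cut-captured c properᶜ
    caps′ = cut-captured c′ properˢ
    is = proj₁ caps ; ds = proj₂ caps ; is′ = proj₁ caps′ ; ds′ = proj₂ caps′
    left : ∀ {v} → v ∈ flat new ch → v ∈ concatMap bag (M ++ M′) → v ∈ Cutset M
    left v∈ v∈M with ∈-marked-++ M v∈M
    ... | inj₁ v∈l = ∈-++⁺ʳ S v∈l
    ... | inj₂ v∈r = contradiction (cut-bags⊆ c′ v∈r) (∉sib (∈-++⁺ʳ (new t) v∈))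
    right : ∀ {v} → v ∈ flat new sib → v ∈ concatMap bag (M ++ M′) → v ∈ Cutset M′
    right v∈ v∈M with ∈-marked-++ M v∈M
    ... | inj₁ v∈l = contradiction (∈-++⁺ʳ (bag t) (cut-bags⊆ c v∈l)) (∉tree v∈)
    ... | inj₂ v∈r = ∈-++⁺ʳ S v∈r
    atNode : ∀ {v} → v ∈ new t → v ∈ Cutset (M ++ M′) → v ∈ fresh t ++ boundary i
    atNode v∈t v∈M with ∈-++⁻ S v∈M
    ... | inj₁ v∈S = ∈-++⁺ˡ (∈-filter⁺ (_∈? S) v∈t v∈S)
    ... | inj₂ v∈′ with ∈-marked-++ M v∈′
    ... | inj₁ v∈l = ∈-++⁺ʳ (fresh t) (marked∩above c properᶜ (∈-++⁺ʳ (inh t) v∈t) v∈l)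
    ... | inj₂ v∈r = contradiction (cut-bags⊆ c′ v∈r) (∉sib (∈-++⁺ˡ v∈t))
    below : ∀ {v} → v ∈ flats new i → v ∈ Cutset (M ++ M′) → v ∈ boundary i
    below v∈ v∈M = let g , g∈ , v∈g = find (∈-concatMap⁻ (flat new ∘ proj₁) {xs = i} v∈) in
      ∈-concatMap proj₂ g∈ (All.lookup (captured-mono M (M ++ M′) (cut-pending⊆ c) left is) g∈ v∈g v∈M)
    top : Captured (M ++ M′) (node t (joined i) [] , fresh t ++ boundary i)
    top v∈ v∈M with ∈-++⁻ (new t) v∈
    ... | inj₁ v∈t = atNode v∈t v∈M
    ... | inj₂ v∈′ = ∈-++⁺ʳ (fresh t) (below
      (subst (_ ∈_) (trans (++-identityʳ _) (flat-joined new i)) v∈′) v∈M)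
  cut-captured {P} {node t ch sib} (mark {i = i} {M = M} {M′ = M′} c c′) pr =
    (λ ()) ∷ captured-mono M′ (t ∷ M ++ M′) (cut-pending⊆ c′) right is′
    , All.++⁺ (All.map⁺ (All.tabulate λ c∈ {v} v∈ v∈M → ∈-++⁺ʳ (bag t)
        (All.lookup (captured-mono M (t ∷ M ++ M′) (cut-pending⊆ c) left is) c∈ v∈ v∈M)))
      (All.++⁺ (captured-mono M (t ∷ M ++ M′) (cut-closed⊆ c) left ds)
               (captured-mono M′ (t ∷ M ++ M′) (cut-closed⊆ c′) right ds′))
    where
    open Branching (branching pr)
    caps  = cut-captured c properᶜ
    caps′ = cut-captured c′ properˢ
    is = proj₁ caps ; ds = proj₂ caps ; is′ = proj₁ caps′ ; ds′ = proj₂ caps′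
    left : ∀ {v} → v ∈ flat new ch → v ∈ concatMap bag (t ∷ M ++ M′) → v ∈ Cutset M
    left v∈ v∈M with ∈-++⁻ (bag t) v∈M
    ... | inj₁ v∈t = contradiction v∈ (Proper.disjoint properᶜ v∈t)
    ... | inj₂ v∈′ with ∈-marked-++ M v∈′
    ... | inj₁ v∈l = ∈-++⁺ʳ S v∈l
    ... | inj₂ v∈r = contradiction (cut-bags⊆ c′ v∈r) (∉sib (∈-++⁺ʳ (new t) v∈))
    right : ∀ {v} → v ∈ flat new sib → v ∈ concatMap bag (t ∷ M ++ M′) → v ∈ Cutset M′
    right v∈ v∈M with ∈-++⁻ (bag t) v∈M
    ... | inj₁ v∈t = contradiction (∈-++⁺ˡ v∈t) (∉tree v∈)
    ... | inj₂ v∈′ with ∈-marked-++ M v∈′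
    ... | inj₁ v∈l = contradiction (∈-++⁺ʳ (bag t) (cut-bags⊆ c v∈l)) (∉tree v∈)
    ... | inj₂ v∈r = ∈-++⁺ʳ S v∈r

  -- Marking a node whose component would have a boundary larger than 2κ replaces
  -- that boundary by one bag, so that all marked bags are paid for by S.
  record CutBound (κ : ℕ) (F : Forest A) : Set where
    field
      {i d}    : List (Comp A)
      {M}      : List A
      cut      : Cut F i d M
      cost     : length (concatMap bag M) + length (boundary i) ≤ length (flat fresh F)
      pending≤ : All (λ c → length (proj₂ c) ≤ κ + κ) i
      closed≤  : All (λ c → length (proj₂ c) ≤ κ + (κ + κ)) d

  cutBound : ∀ {κ} → (∀ t → length (bag t) ≤ κ) → ∀ F → CutBound κ F
  cutBound bag≤ [] = record { cut = [] ; cost = z≤n ; pending≤ = [] ; closed≤ = [] }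
  cutBound {κ} bag≤ (node t ch sib) with cutBound {κ} bag≤ ch | cutBound {κ} bag≤ sib
  -- The threshold 2κ is the price of a mark in `cost`: `bag t` counts once among the marked bags
  -- and once as the boundary handed upwards.
  ... | l | r = choose (length (fresh t ++ boundary L.i) ≤? κ + κ)
    where
    module L = CutBound l
    module R = CutBound r
    open ≤-Reasoning
    f = length (fresh t)
    b = length (boundary L.i) ; b′ = length (boundary R.i)
    m = length (concatMap bag L.M) ; m′ = length (concatMap bag R.M)
    total : length (flat fresh (node t ch sib)) ≡ f + (length (flat fresh ch) + length (flat fresh sib))
    total = trans (length-++ (fresh t)) (cong (f +_) (length-++ (flat fresh ch)))
    marked : length (concatMap bag (L.M ++ R.M)) ≡ m + m′
    marked = trans (cong length (concatMap-++ bag L.M R.M)) (length-++ (concatMap bag L.M))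
    choose : Dec (length (fresh t ++ boundary L.i) ≤ κ + κ) → CutBound κ (node t ch sib)
    choose (yes small) = record
      { cut      = skip L.cut R.cut
      ; cost     = begin
          length (concatMap bag (L.M ++ R.M)) + length ((fresh t ++ boundary L.i) ++ boundary R.i)
            ≡⟨ cong₂ _+_ marked (trans (length-++ (fresh t ++ boundary L.i)) (cong (_+ b′) (length-++ (fresh t)))) ⟩
          (m + m′) + ((f + b) + b′)        ≡⟨ arith m m′ f b b′ ⟩
          f + ((m + b) + (m′ + b′))        ≤⟨ +-monoʳ-≤ f (+-mono-≤ L.cost R.cost) ⟩
          f + (length (flat fresh ch) + length (flat fresh sib)) ≡⟨ total ⟨
          length (flat fresh (node t ch sib)) ∎
      ; pending≤ = small ∷ R.pending≤
      ; closed≤  = All.++⁺ L.closed≤ R.closed≤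
      }
      where
      arith : ∀ m m′ f b b′ → (m + m′) + ((f + b) + b′) ≡ f + ((m + b) + (m′ + b′))
      arith = solve-∀
    choose (no large) = record
      { cut      = mark L.cut R.cut
      ; cost     = begin
          length (bag t ++ concatMap bag (L.M ++ R.M)) + length (bag t ++ boundary R.i)
            ≡⟨ cong₂ _+_ (trans (length-++ (bag t)) (cong (length (bag t) +_) marked)) (length-++ (bag t)) ⟩
          (length (bag t) + (m + m′)) + (length (bag t) + b′)
            ≤⟨ +-mono-≤ (+-monoˡ-≤ (m + m′) (bag≤ t)) (+-monoˡ-≤ b′ (bag≤ t)) ⟩
          (κ + (m + m′)) + (κ + b′)        ≡⟨ arith κ m m′ b′ ⟩
          (κ + κ) + (m + (m′ + b′))
            ≤⟨ +-monoˡ-≤ _ (≤-trans (<⇒≤ (≰⇒> large)) (≤-reflexive (length-++ (fresh t)))) ⟩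
          (f + b) + (m + (m′ + b′))        ≡⟨ arith′ m f b (m′ + b′) ⟩
          f + ((m + b) + (m′ + b′))        ≤⟨ +-monoʳ-≤ f (+-mono-≤ L.cost R.cost) ⟩
          f + (length (flat fresh ch) + length (flat fresh sib)) ≡⟨ total ⟨
          length (flat fresh (node t ch sib)) ∎
      ; pending≤ = ≤-trans (bag≤ t) (m≤m+n κ κ) ∷ R.pending≤
      -- A pending boundary of at most 2κ is joined by the bag of the mark above it: this is the
      -- origin of 3κ.
      ; closed≤  = All.++⁺ (All.map⁺ (All.map (λ ρ≤ → ≤-trans (≤-reflexive (length-++ (bag t)))
                                                         (+-mono-≤ (bag≤ t) ρ≤)) L.pending≤))
                            (All.++⁺ L.closed≤ R.closed≤)
      }
      where
      arith : ∀ κ m m′ b′ → (κ + (m + m′)) + (κ + b′) ≡ (κ + κ) + (m + (m′ + b′))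
      arith = solve-∀
      arith′ : ∀ m f b c → (f + b) + (m + c) ≡ f + ((m + b) + c)
      arith′ = solve-∀

-- Building a tree partition from the top down

Meets : List ℕ → Clause → Set
Meets Z C = Any (_∈ Z) (map var C)

meets? : ∀ Z → Decidable (Meets Z)
meets? Z C = any? (_∈? Z) (map var C)

-- A clause that meets `Z` is dropped as a whole, since it is checked between the parent bag and the
-- root bag of the component, outside the recursive call.
remove : List ℕ → Bags A → Bags A
remove Z β = record
  { inh = filter (¬? ∘ (_∈? Z)) ∘ inh
  ; new = filter (¬? ∘ (_∈? Z)) ∘ new
  ; cls = filter (¬? ∘ meets? Z) ∘ cls
  }
  where open Bags β

record Bounded {A : Set} (neighbours : ℕ → List ℕ) (κ : ℕ) (β : Bags A) : Set where
  open Bags β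
  field
    bag≤        : ∀ t → length (bag t) ≤ κ
    cls⊆        : ∀ {t C} → C ∈ cls t → map var C ⊆ bag t
    neighbours∋ : ∀ {t C x y} → C ∈ cls t → x ∈ map var C → y ∈ map var C → y ∈ neighbours x

module _ (Z : List ℕ) {β : Bags A} where

  private
    module β = Bags β
    module β′ = Bags (remove Z β)
    keep? : Decidable (_∉ Z)
    keep? = ¬? ∘ (_∈? Z)

  remove-bounded : ∀ {neighbours κ} → Bounded neighbours κ β → Bounded neighbours κ (remove Z β)
  remove-bounded bd = record
    { bag≤        = λ t → ≤-trans (≤-reflexive (length-++ (filter keep? (β.inh t))))
                            (≤-trans (+-mono-≤ (length-filter keep? (β.inh t)) (length-filter keep? (β.new t)))
                                     (≤-trans (≤-reflexive (sym (length-++ (β.inh t)))) (Bounded.bag≤ bd t)))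
    ; cls⊆        = λ {t} C∈ x∈ → let C∈′ , free = ∈-filter⁻ (¬? ∘ meets? Z) {xs = β.cls t} C∈
                                      x∉ = λ x∈Z → free (lose x∈ x∈Z) in
        Sum.[ (λ x∈i → ∈-++⁺ˡ (∈-filter⁺ keep? x∈i x∉)) , (λ x∈n → ∈-++⁺ʳ (β′.inh t) (∈-filter⁺ keep? x∈n x∉)) ]
          (∈-++⁻ (β.inh t) (Bounded.cls⊆ bd C∈′ x∈))
    ; neighbours∋ = λ {t} C∈ → Bounded.neighbours∋ bd (proj₁ (∈-filter⁻ (¬? ∘ meets? Z) {xs = β.cls t} C∈))
    }

  remove-nested : ∀ {P Q} F → (∀ {v} → v ∈ P → v ∉ Z → v ∈ Q) → β.Nested P F → β′.Nested Q F
  remove-nested []              P⊆Q _              = tt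
  remove-nested (node t ch sib) P⊆Q (i , nᶜ , nˢ) =
    (λ v∈ → let v∈i , v∉ = ∈-filter⁻ keep? {xs = β.inh t} v∈ in P⊆Q (i v∈i) v∉)
    , remove-nested ch (λ v∈ v∉ → Sum.[ (λ v∈i → ∈-++⁺ˡ (∈-filter⁺ keep? v∈i v∉))
                                      , (λ v∈n → ∈-++⁺ʳ (β′.inh t) (∈-filter⁺ keep? v∈n v∉)) ] (∈-++⁻ (β.inh t) v∈)) nᶜ
    , remove-nested sib P⊆Q nˢ

module TreePartition {A : Set} (neighbours : ℕ → List ℕ) (κ d : ℕ)
                     (neighbours≤ : ∀ v → length (neighbours v) ≤ d) where

  -- A boundary has at most 3κ vertices with at most `d` neighbours each.
  seeds : ℕ
  seeds = (κ + (κ + κ)) * d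

  -- The set S, the bag of the root, and the other marked bags, which together are no larger than S.
  width : ℕ
  width = seeds + (κ + seeds)

  record Solution (β : Bags A) (F : Forest A) (S : List ℕ) : Set where
    open Bags β
    field
      R        : List ℕ
      Φ        : CNF
      ch       : Partition
      R≤       : length R ≤ width
      -- S may contain variables that were already placed in an earlier bag; only those still in the
      -- forest are demanded.
      S⊆R      : ∀ {v} → v ∈ S → v ∈ flat new F → v ∈ R
      Φ⊆       : ∀ {C} → C ∈ Φ → map var C ⊆ R
      below    : Below width R ch
      vars↭    : R ++ vars ch ↭ flat new F
      clauses↭ : Φ ++ clauses ch ↭ flat cls F

  Solver : ℕ → Set
  Solver n = ∀ (β : Bags A) F S → Bounded neighbours κ β → length (flat [_] F) ≤ n → Bags.Nested β [] F →
             Unique (flat (Bags.new β) F) → length S ≤ seeds → Solution β F S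

  module Step (β : Bags A) (bd : Bounded neighbours κ β) {n : ℕ} (solve : Solver n) (Z R : List ℕ) where

    open Bags β
    open Bounded bd

    private
      keep? : Decidable (_∉ Z)
      keep? = ¬? ∘ (_∈? Z)

    record Attachable (c : Comp A) : Set where
      G = proj₁ c
      ρ = proj₂ c
      field
        nested   : Nested ρ G
        within   : ρ ⊆ Z
        captured : ∀ {v} → v ∈ flat new G → v ∈ Z → v ∈ ρ
        ρ≤       : length ρ ≤ κ + (κ + κ)
        bags⊆    : ∀ {v} → v ∈ flat bag G → v ∈ Z → v ∈ R

    attach : ∀ cs → All Attachable cs → Unique (flats new cs) → length (flats [_] cs) ≤ n →
             Σ Partition λ P → Below width R P × vars P ↭ filter keep? (flats new cs) × clauses P ↭ flats cls cs
    attach []             _        _  _  = [] , tt , ↭-refl , ↭-refl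
    attach ((G , ρ) ∷ cs) (a ∷ as) u  ≤n with Unique-++⁻ (flat new G) u
    ... | uG , ucs , _
      with attach cs as ucs (m+n≤o⇒n≤o (length (flat [_] G)) (≤-trans (≤-reflexive (sym (length-++ (flat [_] G)))) ≤n))
    ... | P , below , vars↭ , clauses↭ =
      node Sol.R (U ++ Sol.Φ) Sol.ch P
      , (Sol.R≤ , clauses⊆ , Sol.below , below)
      , ↭-trans (↭-reflexive (sym (++-assoc Sol.R (vars Sol.ch) (vars P))))
          (↭-trans (++⁺ (↭-trans Sol.vars↭ (↭-reflexive (flat-filter keep? new G))) vars↭)
                   (↭-reflexive (sym (filter-++ keep? (flat new G) _))))
      , clausesAll
      where
      open Attachable a using (nested; within; captured; ρ≤; bags⊆)
      S = concatMap neighbours ρ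
      U = filter (meets? Z) (flat cls G)
      sol : Solution (remove Z β) G S
      sol = solve (remove Z β) G S (remove-bounded Z bd)
        (m+n≤o⇒m≤o _ (≤-trans (≤-reflexive (sym (length-++ (flat [_] G)))) ≤n))
        (remove-nested Z G (λ v∈ρ v∉Z → contradiction (within v∈ρ) v∉Z) nested)
        (subst Unique (sym (flat-filter keep? new G)) (Unique.filter⁺ keep? uG))
        (≤-trans (length-concatMap≤ neighbours ρ λ _ → neighbours≤ _) (*-monoˡ-≤ d ρ≤))
      module Sol = Solution sol
      -- A clause of `U` meets `Z` in some `r`, which lies in ρ. Each of its variables in `Z`
      -- belongs to `R`. Any other one is a neighbour of `r`, hence in the set S of the component,
      -- and so was forced into `Sol.R`.
      clauses⊆ : ∀ {C} → C ∈ U ++ Sol.Φ → map var C ⊆ R ++ Sol.R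
      clauses⊆ C∈ x∈ with ∈-++⁻ U C∈
      ... | inj₂ C∈Φ = ∈-++⁺ʳ R (Sol.Φ⊆ C∈Φ x∈)
      ... | inj₁ C∈U with ∈-filter⁻ (meets? Z) {xs = flat cls G} C∈U
      ... | C∈G , meets with flat-find cls G C∈G | find meets
      ... | t , C∈t , t⊆ | r , r∈C , r∈Z with _ ∈? Z
      ... | yes x∈Z = ∈-++⁺ˡ (bags⊆ (t⊆ bag (cls⊆ C∈t x∈)) x∈Z)
      ... | no x∉Z  = ∈-++⁺ʳ R (Sol.S⊆R (∈-concatMap neighbours r∈ρ (neighbours∋ C∈t r∈C x∈))
                        (subst (_ ∈_) (sym (flat-filter keep? new G)) (∈-filter⁺ keep? {xs = flat new G} x∈new x∉Z)))
        where
        r∈ρ : r ∈ ρ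
        r∈ρ = Sum.[ id , (λ r∈new → captured r∈new r∈Z) ] (flat-bag⊆ G nested (t⊆ bag (cls⊆ C∈t r∈C)))
        x∈new : _ ∈ flat new G
        x∈new = Sum.[ (λ x∈ρ → contradiction (within x∈ρ) x∉Z) , id ] (flat-bag⊆ G nested (t⊆ bag (cls⊆ C∈t x∈)))
      clausesAll : (U ++ Sol.Φ) ++ clauses Sol.ch ++ clauses P ↭ flat cls G ++ flats cls cs
      clausesAll = begin
        (U ++ Sol.Φ) ++ clauses Sol.ch ++ clauses P
          ↭⟨ solve⊕ 4 (λ a b c d → (a ⊕ b) ⊕ c ⊕ d ⊜ (a ⊕ b ⊕ c) ⊕ d) ↭-refl U Sol.Φ (clauses Sol.ch) (clauses P) ⟩
        (U ++ Sol.Φ ++ clauses Sol.ch) ++ clauses P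
          ↭⟨ ++⁺ (++⁺ˡ U Sol.clauses↭) clauses↭ ⟩
        (U ++ flat (Bags.cls (remove Z β)) G) ++ flats cls cs
          ≡⟨ cong (λ Ψ → (U ++ Ψ) ++ flats cls cs) (flat-filter (¬? ∘ meets? Z) cls G) ⟩
        (U ++ filter (¬? ∘ meets? Z) (flat cls G)) ++ flats cls cs
          ↭⟨ ++⁺ʳ (flats cls cs) (filter-split-↭ (meets? Z) (flat cls G)) ⟨
        flat cls G ++ flats cls cs ∎
        where open PermutationReasoning
              open ++-Solver renaming (solve to solve⊕)

  solve : ∀ n → Solver n
  solve n β [] S bd _ _ _ _ = record
    { R = [] ; Φ = [] ; ch = [] ; R≤ = z≤n ; S⊆R = λ _ () ; Φ⊆ = λ ()
    ; below = tt ; vars↭ = ↭-refl ; clauses↭ = ↭-refl }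
  solve (suc n) β F@(node t ch sib) S bd (s≤s size≤) nested unique S≤ = record
    { R        = R
    ; Φ        = concatMap cls M
    ; ch       = P
    ; R≤       = ≤-trans (Unique⊆⇒length≤ (Unique.filter⁺ (_∈? Z) unique)
                                  (λ v∈ → proj₂ (∈-filter⁻ (_∈? Z) {xs = flat new F} v∈))) Z≤
    ; S⊆R      = λ v∈S v∈F → ∈-filter⁺ (_∈? Z) {xs = flat new F} v∈F (∈-++⁺ˡ v∈S)
    ; Φ⊆       = λ C∈ x∈ → let u , u∈ , C∈u = find (∈-concatMap⁻ cls {xs = M} C∈)
                               x∈M = ∈-concatMap bag u∈ (cls⊆ C∈u x∈) in
                 bags⊆R (cut-bags⊆ cut x∈M) (∈-++⁺ʳ S x∈M)
    ; below    = proj₁ (proj₂ attached)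
    ; vars↭    = varsAll
    ; clauses↭ = ↭-trans (++⁺ˡ (concatMap cls M) (proj₂ (proj₂ (proj₂ attached))))
                         (↭-trans (pieces cls) (↭-sym (cut-↭ cls cut)))
    }
    where
    open Bags β
    open Bounded bd
    open Cutting β S
    module Cᶜ = CutBound (cutBound {κ} bag≤ ch)
    module Cˢ = CutBound (cutBound {κ} bag≤ sib)
    -- The root is marked regardless of its boundary, so that every component has fewer nodes and
    -- the recursion ends. This costs the single κ in `width`.
    M   = t ∷ Cᶜ.M ++ Cˢ.M
    i   = ([] , bag t) ∷ Cˢ.i
    c   = map (enlarge (bag t)) Cᶜ.i ++ Cᶜ.d ++ Cˢ.d
    cut : Cut F i c M
    cut = mark Cᶜ.cut Cˢ.cut
    Z = S ++ concatMap bag M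
    R = filter (_∈? Z) (flat new F)

    bags⊆R : ∀ {v} → v ∈ flat bag F → v ∈ Z → v ∈ R
    bags⊆R v∈ v∈Z with flat-bag⊆ F nested v∈
    ... | inj₂ v∈F = ∈-filter⁺ (_∈? Z) {xs = flat new F} v∈F v∈Z

    pieces : ∀ {B : Set} (f : A → List B) → concatMap f M ++ flats f (i ++ c) ↭ flats f i ++ flats f c ++ concatMap f M
    pieces f rewrite concatMap-++ (flat f ∘ proj₁) i c =
      solve⊕ 3 (λ m i c → m ⊕ i ⊕ c ⊜ i ⊕ c ⊕ m) ↭-refl (concatMap f M) (flats f i) (flats f c)
      where open ++-Solver renaming (solve to solve⊕)

    whole : ∀ {B : Set} (f : A → List B) → flat f F ↭ concatMap f M ++ flats f (i ++ c)
    whole f = ↭-trans (cut-↭ f cut) (↭-sym (pieces f))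

    ρ≤ : All (λ c → length (proj₂ c) ≤ κ + (κ + κ)) (i ++ c)
    ρ≤ = All.++⁺ (≤-trans (bag≤ t) (m≤m+n κ _) ∷ All.map (λ ≤2κ → ≤-trans ≤2κ (m≤n+m _ κ)) Cˢ.pending≤)
           (All.++⁺ (All.map⁺ (All.map (λ ≤2κ → ≤-trans (≤-reflexive (length-++ (bag t)))
                                                        (+-mono-≤ (bag≤ t) ≤2κ)) Cᶜ.pending≤))
             (All.++⁺ Cᶜ.closed≤ Cˢ.closed≤))

    nests : All (λ (G , ρ) → Nested ρ G) (i ++ c)
    nests = let ns , ns′ = cut-nested cut nested in
      All.++⁺ (All.map (λ {(G , _)} → Nested-mono G λ ()) ns) ns′

    withins : WithinCutset M (i ++ c)
    withins = let ws , ws′ = cut-within cut in All.++⁺ ws ws′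

    captureds : All (Captured M) (i ++ c)
    captureds = let cs , cs′ = cut-captured cut (proper nested unique λ ()) in All.++⁺ cs cs′

    attachables : All (Step.Attachable β bd (solve n) Z R) (i ++ c)
    attachables = All.tabulate λ c∈ → record
      { nested   = All.lookup nests c∈
      ; within   = λ {v} → All.lookup withins c∈ {v}
      ; captured = All.lookup captureds c∈
      ; ρ≤       = All.lookup ρ≤ c∈
      ; bags⊆    = λ v∈ → bags⊆R (∈-resp-↭ (↭-sym (whole bag))
                     (∈-++⁺ʳ (concatMap bag M) (∈-concatMap (flat bag ∘ proj₁) c∈ v∈)))
      }

    attached : _
    attached = Step.attach β bd (solve n) Z R (i ++ c) attachables
      (proj₁ (proj₂ (Unique-++⁻ (concatMap new M) (Unique-resp-↭ (whole new) unique))))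
      (≤-trans (m+n≤o⇒n≤o (length (concatMap [_] (Cᶜ.M ++ Cˢ.M)))
         (≤-pred (≤-reflexive (trans (sym (length-++ (concatMap [_] M))) (sym (↭-length (whole [_]))))))) size≤)
    P = proj₁ attached

    keep? : Decidable (_∉ Z)
    keep? = ¬? ∘ (_∈? Z)

    varsAll : R ++ vars P ↭ flat new F
    varsAll = begin
      R ++ vars P
        ↭⟨ ++⁺ˡ R (proj₁ (proj₂ (proj₂ attached))) ⟩
      R ++ filter keep? (flats new (i ++ c))
        ≡⟨ cong (λ xs → R ++ xs ++ filter keep? (flats new (i ++ c))) (filter-none keep? none) ⟨
      R ++ filter keep? (concatMap new M) ++ filter keep? (flats new (i ++ c))
        ≡⟨ cong (R ++_) (filter-++ keep? (concatMap new M) _) ⟨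
      R ++ filter keep? (concatMap new M ++ flats new (i ++ c))
        ↭⟨ ++⁺ˡ R (filter-↭ keep? (whole new)) ⟨
      R ++ filter keep? (flat new F)
        ↭⟨ filter-split-↭ (_∈? Z) (flat new F) ⟨
      flat new F ∎
      where
      open PermutationReasoning
      none : All (λ v → ¬ (v ∉ Z)) (concatMap new M)
      none = All.tabulate λ v∈ v∉ → let u , u∈ , v∈u = find (∈-concatMap⁻ new {xs = M} v∈) in
        v∉ (∈-++⁺ʳ S (∈-concatMap bag u∈ (∈-++⁺ʳ (inh u) v∈u)))

    Z≤ : length Z ≤ width
    Z≤ = begin
      length Z                                       ≡⟨ length-++ S ⟩
      length S + length (concatMap bag M)            ≤⟨ +-mono-≤ S≤ M≤ ⟩
      seeds + (κ + seeds)                            ∎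
      where
      open ≤-Reasoning
      rest = flat new ch ++ flat new sib
      rest! : Unique rest
      rest! = proj₁ (proj₂ (Unique-++⁻ (new t) unique))
      fresh≡ : flat fresh ch ++ flat fresh sib ≡ filter (_∈? S) rest
      fresh≡ = trans (cong₂ _++_ (flat-filter (_∈? S) new ch) (flat-filter (_∈? S) new sib))
                     (sym (filter-++ (_∈? S) (flat new ch) (flat new sib)))
      -- The marks below the root are paid for by the occurrences of S among the new vertices. No
      -- vertex is new twice, so there are at most |S| of these.
      M≤ : length (concatMap bag M) ≤ κ + seeds
      M≤ = begin
        length (bag t ++ concatMap bag (Cᶜ.M ++ Cˢ.M))
          ≡⟨ length-++ (bag t) ⟩
        length (bag t) + length (concatMap bag (Cᶜ.M ++ Cˢ.M))
          ≡⟨ cong (length (bag t) +_) (trans (cong length (concatMap-++ bag Cᶜ.M Cˢ.M))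
                                             (length-++ (concatMap bag Cᶜ.M))) ⟩
        length (bag t) + (length (concatMap bag Cᶜ.M) + length (concatMap bag Cˢ.M))
          ≤⟨ +-mono-≤ (bag≤ t) (+-mono-≤ (m+n≤o⇒m≤o (length (concatMap bag Cᶜ.M)) Cᶜ.cost)
                                        (m+n≤o⇒m≤o (length (concatMap bag Cˢ.M)) Cˢ.cost)) ⟩
        κ + (length (flat fresh ch) + length (flat fresh sib))
          ≡⟨ cong (κ +_) (trans (sym (length-++ (flat fresh ch))) (cong length fresh≡)) ⟩
        κ + length (filter (_∈? S) rest)
          ≤⟨ +-monoʳ-≤ κ (Unique⊆⇒length≤ (Unique.filter⁺ (_∈? S) rest!)
                                               (λ v∈ → proj₂ (∈-filter⁻ (_∈? S) {xs = rest} v∈))) ⟩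
        κ + length S
          ≤⟨ +-monoʳ-≤ κ S≤ ⟩
        κ + seeds ∎

-- From a tree decomposition to a forest of nested bags

flat-ids : (f : A → List B) (F : Forest A) → concatMap f (flat [_] F) ≡ flat f F
flat-ids f []              = refl
flat-ids f (node t ch sib)
  rewrite concatMap-++ f (flat [_] ch) (flat [_] sib) | flat-ids f ch | flat-ids f sib = refl

Unique-concatMap : (f : A → List B) (ts : List A) → Unique ts → (∀ t → Unique (f t)) →
                   (∀ {t u v} → v ∈ f t → v ∈ f u → t ≡ u) → Unique (concatMap f ts)
Unique-concatMap f []       _          _  _   = []
Unique-concatMap f (t ∷ ts) (t∉ ∷ ts!) f! inj = Unique.++⁺ (f! t) (Unique-concatMap f ts ts! f! inj)
  λ (v∈t , v∈ts) → let u , u∈ , v∈u = find (∈-concatMap⁻ f {xs = ts} v∈ts) in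
    All.lookup t∉ u∈ (inj v∈t v∈u)

insertBelow : ∀ (β : Bags A) {P} F {p u} → Bags.Nested β P F → p ∈ flat [_] F → Bags.inh β u ⊆ Bags.bag β p →
              Σ (Forest A) λ G → Bags.Nested β P G × flat [_] G ↭ u ∷ flat [_] F
insertBelow β (node t ch sib) {u = u} (i , nᶜ , nˢ) (here refl) u⊆ =
  node t (node u [] ch) sib , (i , (u⊆ , tt , nᶜ) , nˢ) , swap t u ↭-refl
insertBelow β (node t ch sib) {u = u} (i , nᶜ , nˢ) (there p∈) u⊆ with ∈-++⁻ (flat [_] ch) p∈
... | inj₁ p∈ch = let G , n , ids↭ = insertBelow β ch nᶜ p∈ch u⊆ in
  node t G sib , (i , n , nˢ) , ↭-trans (prep t (++⁺ʳ _ ids↭)) (swap t u ↭-refl)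
... | inj₂ p∈sib = let G , n , ids↭ = insertBelow β sib nˢ p∈sib u⊆ in
  node t ch G , (i , nᶜ , n) ,
  ↭-trans (prep t (↭-trans (++⁺ˡ (flat [_] ch) ids↭) (shift u (flat [_] ch) _))) (swap t u ↭-refl)

var∈Vars : ∀ φ {C x} → C ∈ φ → x ∈ map var C → x ∈ Vars φ
var∈Vars φ C∈ x∈ = ∈-deduplicate⁺ _≟_ (∈-concatMap (map var) C∈ x∈)

Vars⁻ : ∀ φ {x} → x ∈ Vars φ → ∃ λ C → C ∈ φ × x ∈ map var C
Vars⁻ φ x∈ = find (∈-concatMap⁻ (map var) {xs = φ} (∈-deduplicate⁻ _≟_ (concatMap (map var) φ) x∈))

occursIn⁺ : ∀ {x C} → x ∈ map var C → T (occursIn x C)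
occursIn⁺ {x} {C} x∈ with ∈-map⁻ var x∈
... | l , l∈ , refl = any⁺ _ (lose l∈ (≡⇒≡ᵇ (var l) (var l) refl))

occursIn⁻ : ∀ {x} C → T (occursIn x C) → x ∈ map var C
occursIn⁻ {x} C occ with find (any⁻ _ C occ)
... | l , l∈ , eq = subst (_∈ map var C) (≡ᵇ⇒≡ (var l) x eq) (∈-map⁺ var l∈)

containing : CNF → ℕ → CNF
containing φ x = filterᵇ (occursIn x) φ

containing⁺ : ∀ φ {x C} → C ∈ φ → x ∈ map var C → C ∈ containing φ x
containing⁺ φ C∈ x∈ = ∈-filter⁺ (T? ∘ occursIn _) C∈ (occursIn⁺ x∈)

containing⁻ : ∀ φ x {C} → C ∈ containing φ x → C ∈ φ × x ∈ map var C
containing⁻ φ x {C} C∈ = let C∈φ , occ = ∈-filter⁻ (T? ∘ occursIn x) {xs = φ} C∈ in C∈φ , occursIn⁻ C occ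

∈⇒≤max : ∀ (f : ℕ → ℕ) {x} xs → x ∈ xs → f x ≤ foldr _⊔_ 0 (map f xs)
∈⇒≤max f (x ∷ xs) (here refl) = m≤m⊔n (f x) _
∈⇒≤max f (y ∷ xs) (there x∈)  = ≤-trans (∈⇒≤max f xs x∈) (m≤n⊔m (f y) _)

occ≤Δ : ∀ φ x → occ φ x ≤ Δ φ
occ≤Δ φ x with x ∈? Vars φ
... | yes x∈ = ∈⇒≤max (occ φ) (Vars φ) x∈
... | no x∉  = ≤-trans (≤-reflexive (cong length (filter-none (T? ∘ occursIn x) {φ} (All.tabulate λ {C} C∈ occ →
                 x∉ (var∈Vars φ C∈ (occursIn⁻ C occ)))))) z≤n

module Decomposition (φ : CNF) {k : ℕ} (td : TreeDecomp φ k) where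

  open TreeDecomp td renaming (bag to bagOf)

  Node : Set
  Node = Fin (suc s)

  keep? : ∀ i → Decidable (_∈ bagOf (parent i))
  keep? i = _∈? bagOf (parent i)

  elements : Node → List ℕ
  elements t = deduplicate _≟_ (bagOf t)

  inherited fresh : Node → List ℕ
  inherited Fin.zero    = []
  inherited (Fin.suc i) = filter (keep? i) (elements (Fin.suc i))
  fresh Fin.zero        = elements Fin.zero
  fresh (Fin.suc i)     = filter (¬? ∘ keep? i) (elements (Fin.suc i))

  fresh⇒Top : ∀ {x} t → x ∈ fresh t → Top parent bagOf x t
  fresh⇒Top Fin.zero    x∈ = ∈-deduplicate⁻ _≟_ (bagOf Fin.zero) x∈
  fresh⇒Top (Fin.suc i) x∈ = let x∈′ , x∉ = ∈-filter⁻ (¬? ∘ keep? i) {xs = elements (Fin.suc i)} x∈ in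
                             ∈-deduplicate⁻ _≟_ (bagOf (Fin.suc i)) x∈′ , x∉

  Top⇒fresh : ∀ {x} t → Top parent bagOf x t → x ∈ fresh t
  Top⇒fresh Fin.zero    x∈        = ∈-deduplicate⁺ _≟_ x∈
  Top⇒fresh (Fin.suc i) (x∈ , x∉) = ∈-filter⁺ (¬? ∘ keep? i) (∈-deduplicate⁺ _≟_ x∈) x∉

  Top⇒∈ : ∀ {x} t → Top parent bagOf x t → x ∈ bagOf t
  Top⇒∈ Fin.zero    x∈       = x∈
  Top⇒∈ (Fin.suc i) (x∈ , _) = x∈

  elements↭ : ∀ t → elements t ↭ inherited t ++ fresh t
  elements↭ Fin.zero    = ↭-refl
  elements↭ (Fin.suc i) = filter-split-↭ (keep? i) (elements (Fin.suc i))

  climb : ∀ n {x} u → toℕ u ≤ n → x ∈ bagOf u → ∃ λ t → Top parent bagOf x t × toℕ t ≤ toℕ u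
  climb n       Fin.zero    _         x∈ = Fin.zero , x∈ , z≤n
  climb (suc n) {x} (Fin.suc i) (s≤s i≤n) x∈ with keep? i x
  ... | no x∉   = Fin.suc i , (x∈ , x∉) , ≤-refl
  ... | yes x∈′ = let t , top , t≤ = climb n (parent i) (≤-trans (parent< i) i≤n) x∈′ in
                  t , top , ≤-trans t≤ (m≤n⇒m≤1+n (parent< i))

  top≤ : ∀ {x t u} → Top parent bagOf x t → x ∈ bagOf u → toℕ t ≤ toℕ u
  top≤ {u = u} top x∈ with climb _ u ≤-refl x∈
  ... | t′ , top′ , t′≤ rewrite connected _ _ _ top top′ = t′≤

  -- Climb from the common node `u` while both variables persist. If `x` stops first, this node is
  -- `t` and still holds `y`. If `y` stopped strictly first, its top would have a larger index than
  -- the top of `x`, against the last hypothesis; indices stand in for depth because parents precede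
  -- their children.
  meetAtTop : ∀ n {x y t t′} u → toℕ u ≤ n → x ∈ bagOf u → y ∈ bagOf u →
              Top parent bagOf x t → Top parent bagOf y t′ → toℕ t′ ≤ toℕ t → y ∈ bagOf t
  meetAtTop n       Fin.zero    _         x∈ y∈ top top′ _ rewrite connected _ _ _ top x∈ = y∈
  meetAtTop (suc n) {x} {y} (Fin.suc i) (s≤s i≤n) x∈ y∈ top top′ t′≤t with keep? i x | keep? i y
  ... | no x∉   | _       rewrite connected _ _ _ top (x∈ , x∉) = y∈
  ... | yes x∈′ | yes y∈′ = meetAtTop n (parent i) (≤-trans (parent< i) i≤n) x∈′ y∈′ top top′ t′≤t
  ... | yes x∈′ | no y∉   rewrite connected _ _ _ top′ (y∈ , y∉) =
    contradiction (≤-trans t′≤t (≤-trans (top≤ top x∈′) (parent< i))) 1+n≰n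

  lowestTop : ∀ x xs → All (_∈ Vars φ) (x ∷ xs) → ∃ λ y → ∃ λ t → y ∈ x ∷ xs × Top parent bagOf y t ×
              (∀ {z t′} → z ∈ x ∷ xs → Top parent bagOf z t′ → toℕ t′ ≤ toℕ t)
  lowestTop x xs (x∈ ∷ xs∈) with covers x x∈
  ... | u , x∈u with climb _ u ≤-refl x∈u
  lowestTop x [] _ | _ | t , top , _ = x , t , here refl , top ,
    λ where (here refl) top′ → ≤-reflexive (cong toℕ (connected _ _ _ top′ top))
  lowestTop x (x′ ∷ xs) (_ ∷ xs∈) | _ | t , top , _ with lowestTop x′ xs xs∈
  ... | y , t′ , y∈ , top′ , max with toℕ t ≤? toℕ t′
  ... | yes t≤t′ = y , t′ , there y∈ , top′ , λ where
    (here refl) top″ → ≤-trans (≤-reflexive (cong toℕ (connected _ _ _ top″ top))) t≤t′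
    (there z∈)  top″ → max z∈ top″
  ... | no t≰t′  = x , t , here refl , top , λ where
    (here refl) top″ → ≤-reflexive (cong toℕ (connected _ _ _ top″ top))
    (there z∈)  top″ → ≤-trans (max z∈ top″) (<⇒≤ (≰⇒> t≰t′))

  -- Subtrees with pairwise common nodes: the lowest of their tops lies in all of them.
  clauseBag : ∀ {C} → C ∈ φ → ∃ λ t → All (_∈ bagOf t) (map var C)
  clauseBag {[]}    C∈ = Fin.zero , []
  clauseBag {l ∷ C} C∈ with lowestTop (var l) (map var C) (All.tabulate (var∈Vars φ C∈))
  ... | y , t , y∈ , top , max = t , All.tabulate inBag
    where
    inBag : ∀ {z} → z ∈ map var (l ∷ C) → z ∈ bagOf t
    inBag {z} z∈ with y ≟ z
    ... | yes refl = Top⇒∈ t top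
    ... | no y≢z with edges y z (y≢z , l ∷ C , C∈ , y∈ , z∈)
    ... | u , y∈u , z∈u with climb _ u ≤-refl z∈u
    ... | t′ , top′ , _ = meetAtTop _ u ≤-refl y∈u z∈u top top′ (max z∈ top′)

  within? : ∀ C → Dec (∃ λ t → All (_∈ bagOf t) (map var C))
  within? C = Fin.any? λ t → all? (_∈? bagOf t) (map var C)

  -- The node depends on the clause alone and not on a membership proof, so the clauses stored at a
  -- node can be a filter of φ. The root is a default for clauses that fit into no bag, which does
  -- not happen in φ.
  home : Clause → Node
  home C with within? C
  ... | yes (t , _) = t
  ... | no _        = Fin.zero

  home∋ : ∀ {C} → C ∈ φ → All (_∈ bagOf (home C)) (map var C)
  home∋ {C} C∈ with within? C
  ... | yes (t , all) = all
  ... | no none       = contradiction (clauseBag C∈) none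

  bags : Bags Node
  bags = record { inh = inherited ; new = fresh ; cls = λ t → filter (λ C → home C Fin.≟ t) φ }

  open Bags bags

  ∈-bag⁺ : ∀ {t x} → x ∈ bagOf t → x ∈ bag t
  ∈-bag⁺ {t} x∈ = ∈-resp-↭ (elements↭ t) (∈-deduplicate⁺ _≟_ x∈)

  distinct : Clause → List ℕ
  distinct C = deduplicate _≟_ (map var C)

  -- A clause fits into one bag. This bounds its distinct variables only, since the list may repeat
  -- a variable.
  distinct≤ : ∀ {C} → C ∈ φ → length (distinct C) ≤ suc k
  distinct≤ {C} C∈ with clauseBag C∈
  ... | t , all = ≤-trans (Unique⊆⇒length≤ (UniqueDec.deduplicate-! _≟_ (map var C))
                            (λ x∈ → All.lookup all (∈-deduplicate⁻ _≟_ (map var C) x∈))) (width≤ t)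

  neighbours : ℕ → List ℕ
  neighbours x = concatMap distinct (containing φ x)

  neighbours≤ : ∀ x → length (neighbours x) ≤ Δ φ * suc k
  neighbours≤ x = ≤-trans (length-concatMap≤ distinct (containing φ x) (distinct≤ ∘ proj₁ ∘ containing⁻ φ x))
                          (*-monoˡ-≤ (suc k) (occ≤Δ φ x))

  bounded : Bounded neighbours (suc k) bags
  bounded = record
    { bag≤        = λ t → ≤-trans (≤-reflexive (sym (↭-length (elements↭ t))))
                            (≤-trans (length-deduplicate _≟_ (bagOf t)) (width≤ t))
    ; cls⊆        = λ {t} C∈ x∈ → let C∈φ , eq = ∈-filter⁻ (λ C → home C Fin.≟ t) {xs = φ} C∈ in
                      ∈-bag⁺ {t} (subst (λ t → _ ∈ bagOf t) eq (All.lookup (home∋ C∈φ) x∈))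
    ; neighbours∋ = λ {t} C∈ x∈ y∈ → let C∈φ , _ = ∈-filter⁻ (λ C → home C Fin.≟ t) {xs = φ} C∈ in
                      ∈-concatMap distinct (containing⁺ φ C∈φ x∈) (∈-deduplicate⁺ _≟_ y∈)
    }

  record Grown (j : ℕ) : Set where
    field
      forest : Forest Node
      nested : Nested [] forest
      unique : Unique (flat [_] forest)
      ids≤   : ∀ {t} → t ∈ flat [_] forest → toℕ t ≤ j
      ids∋   : ∀ t → toℕ t ≤ j → t ∈ flat [_] forest

  -- Nodes are inserted by increasing index, each as a leaf; `parent<` guarantees that the parent is
  -- already there.
  grow : ∀ j → j ≤ s → Grown j
  grow zero _ = record
    { forest = node Fin.zero [] [] ; nested = (λ ()) , tt , tt ; unique = [] ∷ []
    ; ids≤ = λ where (here refl) → z≤n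
    ; ids∋ = λ where Fin.zero _ → here refl }
  grow (suc j) j<s = record
    { forest = proj₁ inserted
    ; nested = proj₁ (proj₂ inserted)
    ; unique = Unique-resp-↭ (↭-sym ids↭)
                 (All.tabulate (λ t∈ eq → 1+n≰n (≤-trans (≤-reflexive (trans (sym toℕu) (cong toℕ eq))) (G.ids≤ t∈)))
                  ∷ G.unique)
    ; ids≤   = ids≤ ∘ ∈-resp-↭ ids↭
    ; ids∋   = λ t t≤ → ∈-resp-↭ (↭-sym ids↭) (ids∋ t (m≤n⇒m<n∨m≡n t≤))
    }
    where
    module G = Grown (grow j (<⇒≤ j<s))
    i = fromℕ< j<s
    u = Fin.suc i
    toℕu : toℕ u ≡ suc j
    toℕu = cong suc (Fin.toℕ-fromℕ< j<s)
    inserted = insertBelow bags G.forest {u = u} G.nested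
      (G.ids∋ (parent i) (≤-trans (parent< i) (≤-reflexive (Fin.toℕ-fromℕ< j<s))))
      (λ x∈ → ∈-bag⁺ {parent i} (proj₂ (∈-filter⁻ (keep? i) {xs = elements u} x∈)))
    ids↭ = proj₂ (proj₂ inserted)
    ids≤ : ∀ {t} → t ∈ u ∷ flat [_] G.forest → toℕ t ≤ suc j
    ids≤ (here refl) = ≤-reflexive toℕu
    ids≤ (there t∈)  = m≤n⇒m≤1+n (G.ids≤ t∈)
    ids∋ : ∀ t → toℕ t < suc j ⊎ toℕ t ≡ suc j → t ∈ u ∷ flat [_] G.forest
    ids∋ t (inj₁ (s≤s t≤j)) = there (G.ids∋ t t≤j)
    ids∋ t (inj₂ t≡)        = here (Fin.toℕ-injective (trans t≡ (sym toℕu)))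

  module Whole = Grown (grow s ≤-refl)

  flat∋ : (f : Node → List B) (t : Node) {v : B} → v ∈ f t → v ∈ flat f Whole.forest
  flat∋ f t v∈ = subst (_ ∈_) (flat-ids f Whole.forest)
                   (∈-concatMap f (Whole.ids∋ t (≤-pred (Fin.toℕ<n t))) v∈)

  -- A variable is new exactly at its tops, and `connected` leaves it only one.
  vertices! : Unique (flat new Whole.forest)
  vertices! = subst Unique (flat-ids new Whole.forest) (Unique-concatMap new _ Whole.unique new!
    λ {t} {u} v∈t v∈u → connected _ t u (fresh⇒Top t v∈t) (fresh⇒Top u v∈u))
    where
    new! : ∀ t → Unique (new t)
    new! Fin.zero    = UniqueDec.deduplicate-! _≟_ (bagOf Fin.zero)
    new! (Fin.suc i) = Unique.filter⁺ (¬? ∘ keep? i) (UniqueDec.deduplicate-! _≟_ (bagOf (Fin.suc i)))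

  vertices↭ : flat new Whole.forest ↭ Vars φ
  vertices↭ = ∼bag⇒↭ (unique∧set⇒bag vertices! (UniqueDec.deduplicate-! _≟_ _) (mk⇔ to from))
    where
    to : ∀ {x} → x ∈ flat new Whole.forest → x ∈ Vars φ
    to x∈ = let t , x∈t , _ = flat-find new Whole.forest x∈ in bag⊆V t _ (Top⇒∈ t (fresh⇒Top t x∈t))
    from : ∀ {x} → x ∈ Vars φ → x ∈ flat new Whole.forest
    from {x} x∈ with covers x x∈
    ... | u , x∈u with climb _ u ≤-refl x∈u
    ... | t , top , _ = flat∋ new t (Top⇒fresh t top)

  open TreePartition {Node} neighbours (suc k) (Δ φ * suc k) neighbours≤ using (width; solve; module Solution) public

  conjunction : Σ OBDD λ Z₁ → Σ OBDD λ Z₂ → Represents φ Z₁ Z₂ ×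
                size Z₁ ≤ 2 ^ (width + width) * nvars φ × size Z₂ ≤ 2 ^ (width + width) * nvars φ
  conjunction = partition-represents (node Sol.R Sol.Φ Sol.ch [])
    (Sol.R≤ , Sol.Φ⊆ , Sol.below , tt)
    (↭-trans (++⁺ˡ Sol.R (↭-reflexive (++-identityʳ (vars Sol.ch)))) (↭-trans Sol.vars↭ vertices↭))
    (λ {C} C∈ → ∈-resp-↭ (↭-sym clauses↭) (flat∋ cls (home C) (∈-filter⁺ (λ C′ → home C′ Fin.≟ home C) C∈ refl)))
    (λ C∈ → let t , C∈t , _ = flat-find cls Whole.forest (∈-resp-↭ clauses↭ C∈) in
            proj₁ (∈-filter⁻ (λ C → home C Fin.≟ t) {xs = φ} C∈t))
    where
    module Sol = Solution (solve _ bags Whole.forest [] bounded ≤-refl Whole.nested vertices! z≤n)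
    clauses↭ : Sol.Φ ++ clauses Sol.ch ++ [] ↭ flat cls Whole.forest
    clauses↭ = ↭-trans (++⁺ˡ Sol.Φ (↭-reflexive (++-identityʳ (clauses Sol.ch)))) Sol.clauses↭

  -- Here `width` is 6δκ² + κ, so two bags hold 12δκ² + 2κ variables, at most 14δκ² as δ is
  -- positive. For positive k, κ = k + 1 is at most 2k, which gives 56δk² and hence the constant 28.
  width≤exponent : 1 ≤ k → 1 ≤ Δ φ → width + width ≤ 2 * 28 * Δ φ * k ^ 2
  width≤exponent 1≤k 1≤Δ = begin
    width + width                                   ≡⟨ expand κ δ ⟩
    12 * (δ * (κ * κ)) + 2 * κ                      ≤⟨ +-monoʳ-≤ (12 * (δ * (κ * κ))) (*-monoʳ-≤ 2 κ≤) ⟩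
    12 * (δ * (κ * κ)) + 2 * (δ * (κ * κ))          ≤⟨ +-mono-≤ (*-monoʳ-≤ 12 δκκ≤) (*-monoʳ-≤ 2 δκκ≤) ⟩
    12 * (δ * (k₂ * k₂)) + 2 * (δ * (k₂ * k₂))      ≡⟨ collect k δ ⟩
    2 * 28 * δ * k ^ 2                              ∎
    where
    open ≤-Reasoning
    κ = suc k
    δ = Δ φ
    k₂ = k + k
    κ≤k₂ : κ ≤ k₂
    κ≤k₂ = +-monoˡ-≤ k 1≤k
    κ≤ : κ ≤ δ * (κ * κ)
    κ≤ = ≤-trans (m≤m*n κ κ) (≤-trans (≤-reflexive (sym (*-identityˡ _))) (*-monoˡ-≤ (κ * κ) 1≤Δ))
    δκκ≤ : δ * (κ * κ) ≤ δ * (k₂ * k₂)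
    δκκ≤ = *-monoʳ-≤ δ (*-mono-≤ κ≤k₂ κ≤k₂)
    expand : ∀ κ δ → (((κ + (κ + κ)) * (δ * κ)) + (κ + ((κ + (κ + κ)) * (δ * κ)))) +
                     (((κ + (κ + κ)) * (δ * κ)) + (κ + ((κ + (κ + κ)) * (δ * κ)))) ≡
                     12 * (δ * (κ * κ)) + 2 * κ
    expand = solve-∀
    collect : ∀ k δ → 12 * (δ * ((k + k) * (k + k))) + 2 * (δ * ((k + k) * (k + k))) ≡ 2 * 28 * δ * (k * (k * 1))
    collect = solve-∀

-- Treewidth 0 and the final bound

module _ (φ : CNF) (td : TreeDecomp φ 0) where

  open Decomposition φ td

  singleton-clause : ∀ {C x y} → C ∈ φ → x ∈ map var C → y ∈ map var C → x ≡ y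
  singleton-clause C∈ x∈ y∈ with clauseBag C∈
  ... | t , all = equal (TreeDecomp.bag td t) (TreeDecomp.width≤ td t) (All.lookup all x∈) (All.lookup all y∈)
    where
    equal : ∀ {x y} (zs : List ℕ) → length zs ≤ 1 → x ∈ zs → y ∈ zs → x ≡ y
    equal (z ∷ [])     _        (here refl) (here refl) = refl
    equal (z ∷ _ ∷ _) (s≤s ())

  -- The exponent is 0, so there is one node per variable at most. Each clause has at most one
  -- variable and can be checked as soon as that variable is read; the second OBDD accepts
  -- everything.
  conjunction₀ : Σ OBDD λ Z₁ → Σ OBDD λ Z₂ → Represents φ Z₁ Z₂ ×
                 size Z₁ ≤ 2 ^ 0 * nvars φ × size Z₂ ≤ 2 ^ 0 * nvars φ
  conjunction₀ = represents φ p idle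
    ( (λ C∈ x∈ → contradiction x∈ (null⇒∉ (proj₂ (∈-filter⁻ null? {xs = φ} C∈))))
    , Fits-scan 0 (Vars φ) (λ {x} _ C∈ y∈ → let C∈φ , x∈ = containing⁻ φ x C∈ in here (singleton-clause C∈φ y∈ x∈)))
    (Fits-scan 0 (Vars φ) λ _ ())
    (↭-reflexive (reads-scan (containing φ) (Vars φ))) (↭-reflexive (reads-scan (λ _ → []) (Vars φ)))
    φ⊆ ⊆φ
    where
    null? : Decidable (_≡ [])
    null? []      = yes refl
    null? (_ ∷ _) = no λ ()
    null⇒∉ : ∀ {C x} → C ≡ [] → x ∉ map var C
    null⇒∉ refl ()
    idle = scan (λ _ → []) (Vars φ)
    -- Empty clauses belong to no variable and are checked before the first read.
    p = check (filter null? φ) ∷ scan (containing φ) (Vars φ)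
    checks-p : checks p ≡ filter null? φ ++ concatMap (containing φ) (Vars φ)
    checks-p = cong (filter null? φ ++_) (checks-scan (containing φ) (Vars φ))
    φ⊆ : φ ⊆ checks p ++ checks idle
    φ⊆ {[]}    C∈ = ∈-++⁺ˡ (∈-++⁺ˡ (∈-filter⁺ null? C∈ refl))
    φ⊆ {l ∷ C} C∈ = ∈-++⁺ˡ (subst ((l ∷ C) ∈_) (sym checks-p) (∈-++⁺ʳ (filter null? φ)
      (∈-concatMap (containing φ) (var∈Vars φ C∈ (here refl)) (containing⁺ φ C∈ (here refl)))))
    idle⊆ : ∀ xs {C} → C ∈ checks (scan (λ _ → []) xs) → C ∈ φ
    idle⊆ (x ∷ xs) C∈ = idle⊆ xs C∈
    ⊆φ : checks p ++ checks idle ⊆ φ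
    ⊆φ {C} C∈ with ∈-++⁻ (checks p) C∈
    ... | inj₂ C∈idle = idle⊆ (Vars φ) C∈idle
    ... | inj₁ C∈p with ∈-++⁻ (filter null? φ) (subst (C ∈_) checks-p C∈p)
    ... | inj₁ C∈null = proj₁ (∈-filter⁻ null? {xs = φ} C∈null)
    ... | inj₂ C∈scan = let x , _ , C∈x = find (∈-concatMap⁻ (containing φ) {xs = Vars φ} C∈scan) in
                        proj₁ (containing⁻ φ x C∈x)

1≤Δ : ∀ φ {x} → x ∈ Vars φ → 1 ≤ Δ φ
1≤Δ φ {x} x∈ = let C , C∈ , x∈C = Vars⁻ φ x∈ in ≤-trans (∈-length (containing⁺ φ C∈ x∈C)) (occ≤Δ φ x)

theorem4 : Σ ℕ λ γ → (φ : CNF) → NoDupClauses φ → (k : ℕ) → IsTreewidth φ k →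
    Σ OBDD λ Z₁ → Σ OBDD λ Z₂ → Represents φ Z₁ Z₂
    × size Z₁ ≤ 2 ^ (2 * γ * Δ φ * k ^ 2) * nvars φ
    × size Z₂ ≤ 2 ^ (2 * γ * Δ φ * k ^ 2) * nvars φ
theorem4 = 28 , λ φ _ k (td , _) → bound φ k td
  where
  bound : ∀ φ k → TreeDecomp φ k →
    Σ OBDD λ Z₁ → Σ OBDD λ Z₂ → Represents φ Z₁ Z₂
    × size Z₁ ≤ 2 ^ (2 * 28 * Δ φ * k ^ 2) * nvars φ
    × size Z₂ ≤ 2 ^ (2 * 28 * Δ φ * k ^ 2) * nvars φ
  bound φ zero td = let Z₁ , Z₂ , rep , ≤₁ , ≤₂ = conjunction₀ φ td in
    Z₁ , Z₂ , rep , ≤-trans ≤₁ widen , ≤-trans ≤₂ widen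
    where
    widen : 2 ^ 0 * nvars φ ≤ 2 ^ (2 * 28 * Δ φ * 0 ^ 2) * nvars φ
    widen = *-monoˡ-≤ (nvars φ) (^-monoʳ-≤ 2 {0} {2 * 28 * Δ φ * 0 ^ 2} z≤n)
  bound φ (suc k) td = let Z₁ , Z₂ , rep , ≤₁ , ≤₂ = conjunction in
    Z₁ , Z₂ , rep , ≤-trans ≤₁ widen , ≤-trans ≤₂ widen
    where
    open Decomposition φ td
    widen : 2 ^ (width + width) * nvars φ ≤ 2 ^ (2 * 28 * Δ φ * suc k ^ 2) * nvars φ
    -- Without variables Δ is 0 and the exponent vanishes, but the left side is then 0 as well.
    widen with null⊎index (Vars φ)
    ... | inj₁ null = ≤-trans (≤-reflexive (trans (cong (λ xs → 2 ^ (width + width) * length xs) null)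
                                                  (*-zeroʳ (2 ^ (width + width))))) z≤n
    ... | inj₂ i    = *-monoˡ-≤ (nvars φ) (^-monoʳ-≤ 2 (width≤exponent (s≤s z≤n) (1≤Δ φ (∈-lookup i))))
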